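{- Let $\mathbb{F}$ be a field and let $P$ be a syntactic multilinear ABP of size $S$ computing a multilinear polynomial $f\in\mathbb{F}[x_1,\ldots,x_n]$. Then there is a syntactic multilinear formula $\Phi$ computing $f$, of size $S^{O(\log n)}$ and depth $O(\log n)$, such that every leaf $w$ of $\Phi$ represents a multilinear polynomial $[u,v]_{P_w}$ for some nodes $u,v$ in $P_w$ with $|X_{u,v}|\le\sqrt n$, where $P_w$ is a subprogram of $P$. Further, any parse tree of $\Phi$ has at most $3\sqrt n$ leaves.
   Context: Let $X=\{x_1,\ldots,x_n\}$. An algebraic branching program (ABP) $P$ over $\mathbb{F}$ is a directed acyclic graph whose vertices are partitioned into layers $L_0,\ldots,L_\ell$, with edges only from $L_i$ to $L_{i+1}$; $L_0=\{s\}$ (source, the one vertex of in-degree 0) and $L_\ell=\{t\}$ (sink, the one vertex of out-degree 0). Each edge is labeled by an element of $X\cup\mathbb{F}$. The size is the number of nodes. The polynomial computed is the sum over all $s$-to-$t$ paths of the product of the edge labels. $P$ is syntactic multilinear if every variable occurs at most once on every $s$-to-$t$ path. A subprogram of $P$ is a program formed by some of the nodes and edges of $P$ (with their labels), with a designated source and sink. For nodes $u,v$ of a program $P'$, $[u,v]_{P'}$ is the polynomial computed by the subprogram of $P'$ with source $u$ and sink $v$, i.e. the sum over all $u$-to-$v$ paths in $P'$ of the product of the edge labels, and $X_{u,v}$ is the set of all variables that occur as labels on some $u$-to-$v$ path in the program in question. An arithmetic circuit over $\mathbb{F}$ is a directed acyclic graph with vertices (gates) of in-degree at most 2; gates of in-degree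 0 (input gates, or leaves) are labeled by elements of $X\cup\mathbb{F}$, internal gates are labeled $+$ or $\times$, and a gate of out-degree 0 is an output gate. Every gate naturally computes a polynomial, and the circuit computes the polynomial at its output gate. The size is the number of gates and the depth is the length of the longest path from an input gate to the output gate. An arithmetic formula is an arithmetic circuit whose underlying undirected graph is a tree; in the statement above the leaves of the formula $\Phi$ represent multilinear polynomials as described there, instead of single variables or constants. A circuit or formula is syntactic multilinear if the children of every product gate depend on disjoint sets of variables. A parse tree of a formula is a subtree containing the output gate such that for every $+$ gate in it exactly one child is in it, and for every $\times$ gate in it both children are in it.
   Formalization: Sum gates of the formula may have arbitrary fan-in (product gates are binary): with in-degree at most 2, depth O(log n) would force size n^{O(1)}, and the claim fails by counting. It is also assumed that n ≥ 1. -}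

module Defs where

open import Algebra.Apartness.Bundles using (HeytingField)
open import Data.Bool using (if_then_else_)
open import Data.Fin using (Fin; toℕ)
import Data.Fin as Fin
open import Data.Fin.Subset using (Subset; ⊥; _∈_; _∪_; _∩_; ⋃; ⁅_⁆; Empty)
open import Data.List using (List; []; _∷_; _++_; map; concatMap; cartesianProductWith; foldr; allFin; upTo)
open import Data.List.Relation.Unary.Unique.Propositional using (Unique)
open import Data.Maybe using (Maybe; just; nothing)
open import Data.Nat using (ℕ; zero; suc; _+_; _*_; _≤_; _⊔_)
import Data.Nat as ℕ
open import Data.Product using (_×_; _,_; proj₁; proj₂)
import Data.Unit.Polymorphic as Unit
open import Data.Vec using (Vec; zipWith; replicate; lookup; _[_]≔_)
import Data.Vec.Functional as Vector
open import Data.Vec.Properties using (≡-dec)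
open import Function.Bundles using (_⇔_)
open import Level using (Level) renaming (_⊔_ to _⊔ˡ_)
open import Relation.Binary.PropositionalEquality using (_≡_; refl)
open import Relation.Nullary.Decidable using (does; yes; no)

-- Formulas whose leaves carry data from L.  Product gates are binary; sum
-- gates have arbitrary positive fan-in, which is what makes depth O(log n)
-- possible (with binary sums, depth O(log n) would force size n^O(1)).
data Formula {a : Level} (L : Set a) : Set a where
  leaf : L → Formula L
  sum  : (k : ℕ) → (Fin (suc k) → Formula L) → Formula L
  prod : Formula L → Formula L → Formula L

module _ {a : Level} {L : Set a} where

  formulaSize : Formula L → ℕ
  formulaSize (leaf _)   = 1
  formulaSize (sum k φ)  = suc (Vector.foldr _+_ 0 (λ i → formulaSize (φ i)))
  formulaSize (prod φ ψ) = suc (formulaSize φ + formulaSize ψ)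

  formulaDepth : Formula L → ℕ
  formulaDepth (leaf _)   = 0
  formulaDepth (sum k φ)  = suc (Vector.foldr _⊔_ 0 (λ i → formulaDepth (φ i)))
  formulaDepth (prod φ ψ) = suc (formulaDepth φ ⊔ formulaDepth ψ)

  AllLeaves : {q : Level} → (L → Set q) → Formula L → Set q
  AllLeaves Q (leaf w)   = Q w
  AllLeaves Q (sum k φ)  = ∀ i → AllLeaves Q (φ i)
  AllLeaves Q (prod φ ψ) = AllLeaves Q φ × AllLeaves Q ψ

  data ParseTree : Formula L → Set a where
    leaf : (w : L) → ParseTree (leaf w)
    sum  : ∀ {k} {φ : Fin (suc k) → Formula L} (i : Fin (suc k)) →
           ParseTree (φ i) → ParseTree (sum k φ)
    prod : ∀ {φ ψ} → ParseTree φ → ParseTree ψ → ParseTree (prod φ ψ)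

  leafCount : ∀ {φ} → ParseTree φ → ℕ
  leafCount (leaf _)   = 1
  leafCount (sum _ T)  = leafCount T
  leafCount (prod T U) = leafCount T + leafCount U

  module _ {n : ℕ} (leafVars : L → Subset n) where

    formulaVars : Formula L → Subset n
    formulaVars (leaf w)   = leafVars w
    formulaVars (sum k φ)  = Vector.foldr _∪_ ⊥ (λ i → formulaVars (φ i))
    formulaVars (prod φ ψ) = formulaVars φ ∪ formulaVars ψ

    SyntacticMultilinearFormula : Formula L → Set
    SyntacticMultilinearFormula (leaf _)   = Unit.⊤
    SyntacticMultilinearFormula (sum k φ)  =
      ∀ i → SyntacticMultilinearFormula (φ i)
    SyntacticMultilinearFormula (prod φ ψ) =
      Empty (formulaVars φ ∩ formulaVars ψ) ×
      SyntacticMultilinearFormula φ × SyntacticMultilinearFormula ψ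

module Programs {c ℓ₁ ℓ₂ : Level} (F : HeytingField c ℓ₁ ℓ₂) (n : ℕ) where

  private module F = HeytingField F

  Monomial : Set
  Monomial = Vec ℕ n

  -- A polynomial is a finite formal sum of terms; repeated monomials and zero
  -- coefficients are allowed, and equality _≈ₚ_ compares total coefficients.
  Poly : Set c
  Poly = List (F.Carrier × Monomial)

  coeff : Poly → Monomial → F.Carrier
  coeff []            m = F.0#
  coeff ((a , k) ∷ p) m =
    (if does (≡-dec ℕ._≟_ k m) then a else F.0#) F.+ coeff p m

  infix 4 _≈ₚ_
  _≈ₚ_ : Poly → Poly → Set ℓ₁
  p ≈ₚ q = ∀ m → coeff p m F.≈ coeff q m

  0ₚ : Poly
  0ₚ = []

  constₚ : F.Carrier → Poly
  constₚ a = (a , replicate n 0) ∷ []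

  1ₚ : Poly
  1ₚ = constₚ F.1#

  varₚ : Fin n → Poly
  varₚ i = (F.1# , replicate n 0 [ i ]≔ 1) ∷ []

  infixl 6 _+ₚ_
  _+ₚ_ : Poly → Poly → Poly
  _+ₚ_ = _++_

  infixl 7 _*ₚ_
  _*ₚ_ : Poly → Poly → Poly
  _*ₚ_ = cartesianProductWith
    (λ s t → proj₁ s F.* proj₁ t , zipWith _+_ (proj₂ s) (proj₂ t))

  Multilinear : Poly → Set ℓ₁
  Multilinear p = ∀ m i → 2 ≤ lookup m i → coeff p m F.≈ F.0#

  data Label : Set c where
    var   : Fin n → Label
    const : F.Carrier → Label

  labelPoly : Label → Poly
  labelPoly (var i)   = varₚ i
  labelPoly (const a) = constₚ a

  -- Simple digraphs on Fin N: at most one edge per ordered pair of nodes.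
  Edges : ℕ → Set c
  Edges N = Fin N → Fin N → Maybe Label

  module _ {N : ℕ} (E : Edges N) where

    data Path : Fin N → Fin N → Set c where
      []   : ∀ {u} → Path u u
      step : ∀ {u w v a} → E u w ≡ just a → Path w v → Path u v

    labels : ∀ {u v} → Path u v → List Label
    labels []                 = []
    labels (step {a = a} _ p) = a ∷ labels p

    pathVars : ∀ {u v} → Path u v → List (Fin n)
    pathVars p = concatMap occurrences (labels p)
      where
      occurrences : Label → List (Fin n)
      occurrences (var i)   = i ∷ []
      occurrences (const _) = []

    weight : ∀ {u v} → Path u v → Poly
    weight p = foldr _*ₚ_ 1ₚ (map labelPoly (labels p))

    pathsOfLength : ℕ → (u v : Fin N) → List (Path u v)
    pathsOfLength zero    u v with u Fin.≟ v
    ... | yes refl = [] ∷ []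
    ... | no _     = []
    pathsOfLength (suc k) u v = concatMap (λ w → via w (E u w) refl) (allFin N)
      where
      via : (w : Fin N) (e : Maybe Label) → E u w ≡ e → List (Path u v)
      via w (just a) eq = map (step eq) (pathsOfLength k w v)
      via w nothing  _  = []

    -- All u-v paths with at most d edges.  This is the list of all u-v paths
    -- when the graph has layers 0, …, d, with every edge going up one layer.
    paths : ℕ → (u v : Fin N) → List (Path u v)
    paths d u v = concatMap (λ k → pathsOfLength k u v) (upTo (suc d))

    pathPoly : ℕ → (u v : Fin N) → Poly
    pathPoly d u v = foldr _+ₚ_ 0ₚ (map weight (paths d u v))

    varsBetween : ℕ → (u v : Fin N) → Subset n
    varsBetween d u v =
      ⋃ (map (λ p → ⋃ (map ⁅_⁆ (pathVars p))) (paths d u v))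

  record ABP : Set c where
    field
      size         : ℕ
      ℓ            : ℕ
      layer        : Fin size → Fin (suc ℓ)
      edge         : Edges size
      edge-layer   : ∀ {u v a} → edge u v ≡ just a →
                     toℕ (layer v) ≡ suc (toℕ (layer u))
      source       : Fin size
      sink         : Fin size
      layer-source : ∀ v → toℕ (layer v) ≡ 0 ⇔ v ≡ source
      layer-sink   : ∀ v → toℕ (layer v) ≡ ℓ ⇔ v ≡ sink
      sole-source  : ∀ v → (∀ u → edge u v ≡ nothing) ⇔ v ≡ source
      sole-sink    : ∀ u → (∀ v → edge u v ≡ nothing) ⇔ u ≡ sink

    polynomial : Poly
    polynomial = pathPoly edge ℓ source sink

    SyntacticMultilinear : Set c
    SyntacticMultilinear =
      (p : Path edge source sink) → Unique (pathVars edge p)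

  infix 4 _Computes_
  _Computes_ : ABP → Poly → Set ℓ₁
  P Computes f = ABP.polynomial P ≈ₚ f

  -- A subprogram is itself a program: its source and sink are its only nodes of
  -- in-degree 0 and of out-degree 0.  Its layers are inherited from P.
  record Subprogram (P : ABP) : Set c where
    open ABP P using (size)
    field
      nodes       : Subset size
      edge        : Edges size
      edge-nodes  : ∀ {u v a} → edge u v ≡ just a → u ∈ nodes × v ∈ nodes
      edge-label  : ∀ {u v a} → edge u v ≡ just a → ABP.edge P u v ≡ just a
      source      : Fin size
      sink        : Fin size
      source∈     : source ∈ nodes
      sink∈       : sink ∈ nodes
      sole-source : ∀ v → v ∈ nodes → (∀ u → edge u v ≡ nothing) ⇔ v ≡ source
      sole-sink   : ∀ u → u ∈ nodes → (∀ v → edge u v ≡ nothing) ⇔ u ≡ sink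

    [_,_] : (u v : Fin size) → Poly
    [ u , v ] = pathPoly edge (ABP.ℓ P) u v

    X[_,_] : (u v : Fin size) → Subset n
    X[ u , v ] = varsBetween edge (ABP.ℓ P) u v

  record Leaf (P : ABP) : Set c where
    field
      program : Subprogram P
      u v     : Fin (ABP.size P)
      u∈      : u ∈ Subprogram.nodes program
      v∈      : v ∈ Subprogram.nodes program

    leafPoly : Poly
    leafPoly = Subprogram.[_,_] program u v

    leafVars : Subset n
    leafVars = Subprogram.X[_,_] program u v

  open Leaf public using (leafPoly; leafVars)

  formulaPoly : ∀ {P} → Formula (Leaf P) → Poly
  formulaPoly (leaf w)   = leafPoly w
  formulaPoly (sum k φ)  = Vector.foldr _+ₚ_ 0ₚ (λ i → formulaPoly (φ i))
  formulaPoly (prod φ ψ) = formulaPoly φ *ₚ formulaPoly ψ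

  -- k ≤ r √n for natural numbers k, r, expressed without reals.
  infix 4 _≤_√n
  _≤_√n : ℕ → ℕ → Set
  k ≤ r √n = k * k ≤ r * r * n

{-# OPTIONS --safe #-}
-- Let k = ⌊√n⌋ and write X u v for the set of variables on u-v paths.  If a
-- block [u,v] has |X u v| < (r+1)(k+1) with r = r₁ + r₂ + 1, then along every
-- u-v path |X u w| increases, and the first edge (w,w′) at which it reaches
-- t = (r₁+1)(k+1) splits the path uniquely, so that
--   [u,v] = Σ [u,w] · label(w,w′) · [w′,v]
-- over the edges with |X u w| < t ≤ |X u w′|.  By syntactic multilinearity
-- X u w′ and X w′ v are disjoint, whence |X w′ v| < (r₂+1)(k+1).  Halving r
-- from r = k (as n < (k+1)²) down to r = 0 takes at most log n rounds, and
-- a parse tree of the result has at most 2r+1 = 2k+1 ≤ 3√n leaves.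
-- All leaves are blocks of P itself, so no proper subprogram is needed.
module Submission where

open import Defs
open import Algebra.Apartness.Bundles using (HeytingField; HeytingCommutativeRing)
open import Algebra.Bundles using (CommutativeRing; Semiring)
import Algebra.Properties.CommutativeSemigroup as CommutativeSemigroupProperties
import Algebra.Properties.Semiring.Sum as SemiringSum
open import Data.Bool using (true; false; if_then_else_)
open import Data.Empty using (⊥-elim)
open import Data.Fin using (Fin; toℕ)
import Data.Fin as Fin
import Data.Fin.Properties as Finₚ
open import Data.Fin.Subset using (Subset; ⊥; inside; outside; _∈_; _⊆_; _∪_; _∩_; ⋃; ∣_∣; Empty; ⁅_⁆)
import Data.Fin.Subset as Subset
open import Data.Fin.Subset.Properties using (drop-∷-Empty; Empty-unique; nonempty?; ∉⊥; ∈⊤; ∣⊥∣≡0; x∈⁅x⁆; x∈⁅y⁆⇒x≡y; ∣⁅x⁆∣≡1; x∈p∪q⁺; x∈p∪q⁻; x∈p∩q⁻; p⊆q⇒∣p∣≤∣q∣; ∣p∣≤n)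
open import Data.List using (List; []; _∷_; _++_; _∷ʳ_; map; foldr; concatMap; allFin; tabulate; upTo; applyUpTo)
import Data.List.Membership.Propositional as List
open import Data.List.Membership.Propositional.Properties using (∈-++⁺ˡ; ∈-++⁺ʳ; ∈-++⁻; ∈-map⁺; ∈-concatMap⁺; ∈-allFin; ∈-upTo⁺; ∈-cartesianProductWith⁻)
import Data.List.Properties as Listₚ
import Data.List.Relation.Unary.All as All
import Data.List.Relation.Unary.All.Properties as Allₚ
open import Data.List.Relation.Unary.AllPairs as AllPairs using (_∷_)
open import Data.List.Relation.Unary.Any using (here; there)
open import Data.List.Relation.Unary.Unique.Propositional using (Unique)
open import Data.Maybe using (Maybe; just; nothing; maybe′)
import Data.Maybe.Properties as Maybeₚ
open import Data.Nat using (ℕ; zero; suc; _+_; _*_; _∸_; _^_; _⊔_; _≤_; _<_; z≤n; s≤s; ⌊_/2⌋; ⌈_/2⌉)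
import Data.Nat as ℕ
open import Data.Nat.Induction using (<-rec)
open import Data.Nat.Logarithm using (⌈log₂_⌉; ⌈log₂⌉-mono-≤; ⌈log₂⌈n/2⌉⌉≡⌈log₂n⌉∸1; ⌈log₂2^n⌉≡n)
import Data.Nat.Properties as ℕₚ
open import Data.Nat.Tactic.RingSolver using (solve-∀)
open import Data.Product using (Σ-syntax; ∃-syntax; _×_; _,_; proj₁; proj₂)
open import Data.Sum using (inj₁; inj₂; [_,_]′)
open import Data.Unit using (⊤; tt)
import Data.Unit.Polymorphic as Unit
open import Data.Vec using (_∷_; here; there; lookup; replicate; zipWith; _[_]≔_)
import Data.Vec as Vec
import Data.Vec.Functional as Vector
open import Data.Vec.Properties using (≡-dec; lookup-zipWith; lookup-replicate; lookup∘update; lookup∘update′; zipWith-assoc; zipWith-identityˡ; zipWith-identityʳ)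
open import Function using (_∘_; _∋_; id)
open import Function.Bundles using (Equivalence)
open import Level using (Level) renaming (_⊔_ to _⊔ˡ_)
open import Relation.Binary.PropositionalEquality as ≡ using (_≡_; _≢_; refl; cong; subst; subst₂)
import Relation.Binary.Reasoning.Setoid as SetoidReasoning
open import Relation.Binary.Structures using (IsEquivalence)
open import Relation.Nullary using (¬_; Dec; yes; no; does; _×-dec_; ¬?)

-- Thresholds are multiples of k+1 so that nothing is lost to rounding: a cut divides the bound r+1
-- exactly into (r₁+1) + (r₂+1), and a parse tree ends with at most r+1 small blocks joined by r
-- crossing edges. The identity for [u,v] is not proved by a bijection between lists of paths. The
-- matrix of blocks satisfies a first-step recurrence, the sum over crossing edges satisfies a
-- matching one, and induction on the remaining layers compares them; this algebra needs a semiring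
-- of polynomials and its laws for finite sums. In the formula the sum runs over all pairs (w,w′),
-- as two nested sums of fan-in S. A pair that is no crossing edge needs a summand 0, and since
-- every leaf has to be a block, 0 is taken to be the block from the sink back to the source. One
-- round therefore costs depth 4 (two sums, two products) and a size factor S⁵: S² for the sums, and
-- S³ ≥ 8 to absorb both recursive copies, the label and the gates.

n≤2^⌈log₂n⌉ : ∀ n → n ≤ 2 ^ ⌈log₂ n ⌉
n≤2^⌈log₂n⌉ = <-rec _ bound
  where
  open ℕₚ.≤-Reasoning
  bound : ∀ n → (∀ {m} → m < n → m ≤ 2 ^ ⌈log₂ m ⌉) → n ≤ 2 ^ ⌈log₂ n ⌉
  bound zero          _   = z≤n
  bound (suc zero)    _   = ℕₚ.≤-refl
  bound (suc (suc m)) rec = begin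
    n                                ≡⟨ ℕₚ.⌊n/2⌋+⌈n/2⌉≡n n ⟨
    ⌊ n /2⌋ + ⌈ n /2⌉                ≤⟨ ℕₚ.+-monoˡ-≤ ⌈ n /2⌉ (ℕₚ.⌊n/2⌋≤⌈n/2⌉ n) ⟩
    ⌈ n /2⌉ + ⌈ n /2⌉                ≤⟨ ℕₚ.+-mono-≤ half half ⟩
    2 ^ (l ∸ 1) + 2 ^ (l ∸ 1)        ≡⟨ cong (2 ^ (l ∸ 1) +_) (ℕₚ.+-identityʳ _) ⟨
    2 ^ (1 + (l ∸ 1))                ≡⟨ cong (2 ^_) (ℕₚ.m+[n∸m]≡n 1≤l) ⟩
    2 ^ l                            ∎
    where
    n = suc (suc m)
    l = ⌈log₂ n ⌉
    1≤l : 1 ≤ l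
    1≤l = subst (_≤ l) (⌈log₂2^n⌉≡n 1) (⌈log₂⌉-mono-≤ {2} {n} (s≤s (s≤s z≤n)))
    half : ⌈ n /2⌉ ≤ 2 ^ (l ∸ 1)
    half = subst (λ e → ⌈ n /2⌉ ≤ 2 ^ e) (⌈log₂⌈n/2⌉⌉≡⌈log₂n⌉∸1 n) (rec (ℕₚ.⌈n/2⌉<n m))

integerSqrt : ∀ n → ∃[ k ] (k * k ≤ n × n < suc k * suc k)
integerSqrt zero = 0 , z≤n , s≤s z≤n
integerSqrt (suc n) with integerSqrt n
... | k , k²≤n , n<[1+k]² with suc n ℕₚ.<? suc k * suc k
... | yes 1+n<[1+k]² = k , ℕₚ.m≤n⇒m≤1+n k²≤n , 1+n<[1+k]²
... | no  1+n≮[1+k]² = suc k , ℕₚ.≮⇒≥ 1+n≮[1+k]² , (begin-strict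
    suc n                   ≤⟨ n<[1+k]² ⟩
    suc k * suc k           <⟨ ℕₚ.*-mono-< (ℕₚ.n<1+n (suc k)) (ℕₚ.n<1+n (suc k)) ⟩
    suc (suc k) * suc (suc k) ∎)
    where open ℕₚ.≤-Reasoning

≤k⇒≤√n : ∀ {k m n} → k * k ≤ n → m ≤ k → m * m ≤ 1 * 1 * n
≤k⇒≤√n {n = n} k²≤n m≤k =
  ℕₚ.≤-trans (ℕₚ.*-mono-≤ m≤k m≤k) (ℕₚ.≤-trans k²≤n (ℕₚ.≤-reflexive (≡.sym (ℕₚ.*-identityˡ n))))

1≤√n : ∀ {n} → 1 ≤ n → ∀ k → n < suc k * suc k → 1 ≤ k
1≤√n 1≤n zero    n<1 = ⊥-elim (ℕₚ.<⇒≱ n<1 1≤n)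
1≤√n _   (suc k) _   = s≤s z≤n

-- The summand 1 is absorbed because `1 ≤ k`: 1 + 2k ≤ 3k, and then k² ≤ n is scaled by 9.
≤1+2√n⇒≤3√n : ∀ {n m} k → 1 ≤ k → k * k ≤ n → m ≤ 1 + 2 * k → m * m ≤ 3 * 3 * n
≤1+2√n⇒≤3√n {n} {m} k 1≤k k²≤n m≤ = begin
  m * m              ≤⟨ ℕₚ.*-mono-≤ m≤3k m≤3k ⟩
  3 * k * (3 * k)    ≡⟨ ℕₚ.[m*n]*[o*p]≡[m*o]*[n*p] 3 k 3 k ⟩
  3 * 3 * (k * k)    ≤⟨ ℕₚ.*-monoʳ-≤ 9 k²≤n ⟩
  3 * 3 * n          ∎
  where
  open ℕₚ.≤-Reasoning
  m≤3k : m ≤ 3 * k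
  m≤3k = ℕₚ.≤-trans m≤ (ℕₚ.+-monoˡ-≤ (2 * k) 1≤k)

-- Finite sets, duplicate-free lists and bounds on folds

∣p∣+∣q∣≤∣p∪q∣ : ∀ {n} (p q : Subset n) → Empty (p ∩ q) → ∣ p ∣ + ∣ q ∣ ≤ ∣ p ∪ q ∣
∣p∣+∣q∣≤∣p∪q∣ Vec.[]        Vec.[]        _     = z≤n
∣p∣+∣q∣≤∣p∪q∣ (inside  ∷ p) (inside  ∷ q) empty = ⊥-elim (empty (Fin.zero , here))
∣p∣+∣q∣≤∣p∪q∣ (inside  ∷ p) (outside ∷ q) empty = s≤s (∣p∣+∣q∣≤∣p∪q∣ p q (drop-∷-Empty empty))
∣p∣+∣q∣≤∣p∪q∣ (outside ∷ p) (inside  ∷ q) empty =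
  ℕₚ.≤-trans (ℕₚ.≤-reflexive (ℕₚ.+-suc ∣ p ∣ ∣ q ∣)) (s≤s (∣p∣+∣q∣≤∣p∪q∣ p q (drop-∷-Empty empty)))
∣p∣+∣q∣≤∣p∪q∣ (outside ∷ p) (outside ∷ q) empty = ∣p∣+∣q∣≤∣p∪q∣ p q (drop-∷-Empty empty)

module _ {a : Level} {A : Set a} {n : ℕ} (f : A → Subset n) where

  ∈-⋃-map⁺ : ∀ {i x xs} → x List.∈ xs → i ∈ f x → i ∈ ⋃ (map f xs)
  ∈-⋃-map⁺ (here refl) i∈ = x∈p∪q⁺ (inj₁ i∈)
  ∈-⋃-map⁺ (there x∈) i∈ = x∈p∪q⁺ (inj₂ (∈-⋃-map⁺ x∈ i∈))

  ∈-⋃-map⁻ : ∀ {i} xs → i ∈ ⋃ (map f xs) → ∃[ x ] (x List.∈ xs × i ∈ f x)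
  ∈-⋃-map⁻ []       i∈ = ⊥-elim (∉⊥ i∈)
  ∈-⋃-map⁻ (x ∷ xs) i∈ with x∈p∪q⁻ (f x) _ i∈
  ... | inj₁ i∈fx = x , here refl , i∈fx
  ... | inj₂ i∈⋃ with ∈-⋃-map⁻ xs i∈⋃
  ...   | y , y∈xs , i∈fy = y , there y∈xs , i∈fy

module _ {a : Level} {A : Set a} where

  Unique-++⁻ˡ : ∀ (xs : List A) {ys} → Unique (xs ++ ys) → Unique xs
  Unique-++⁻ˡ []       _        = AllPairs.[]
  Unique-++⁻ˡ (x ∷ xs) (x≢ ∷ u) = Allₚ.++⁻ˡ xs x≢ ∷ Unique-++⁻ˡ xs u

  Unique-++⁻ʳ : ∀ (xs : List A) {ys} → Unique (xs ++ ys) → Unique ys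
  Unique-++⁻ʳ []       u       = u
  Unique-++⁻ʳ (x ∷ xs) (_ ∷ u) = Unique-++⁻ʳ xs u

  Unique-++⁻-disjoint : ∀ {xs ys : List A} {x} → Unique (xs ++ ys) → x List.∈ xs → ¬ (x List.∈ ys)
  Unique-++⁻-disjoint {xs = x ∷ xs} (x≢ ∷ _) (here refl) x∈ys = All.lookup x≢ (∈-++⁺ʳ xs x∈ys) refl
  Unique-++⁻-disjoint (_ ∷ u) (there x∈xs) x∈ys = Unique-++⁻-disjoint u x∈xs x∈ys

foldr-+-≤ : ∀ {m s} (f : Fin m → ℕ) → (∀ i → f i ≤ s) → Vector.foldr _+_ 0 f ≤ m * s
foldr-+-≤ {zero}  f f≤ = z≤n
foldr-+-≤ {suc m} f f≤ = ℕₚ.+-mono-≤ (f≤ Fin.zero) (foldr-+-≤ (f ∘ Fin.suc) (f≤ ∘ Fin.suc))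

foldr-⊔-≤ : ∀ {m d} (f : Fin m → ℕ) → (∀ i → f i ≤ d) → Vector.foldr _⊔_ 0 f ≤ d
foldr-⊔-≤ {zero}  f f≤ = z≤n
foldr-⊔-≤ {suc m} f f≤ = ℕₚ.⊔-lub (f≤ Fin.zero) (foldr-⊔-≤ (f ∘ Fin.suc) (f≤ ∘ Fin.suc))

foldr-∪-⊆ : ∀ {m n} {V : Subset n} (f : Fin m → Subset n) → (∀ i → f i ⊆ V) → Vector.foldr _∪_ ⊥ f ⊆ V
foldr-∪-⊆ {zero}  f f⊆ i∈ = ⊥-elim (∉⊥ i∈)
foldr-∪-⊆ {suc m} f f⊆ i∈ =
  [ f⊆ Fin.zero , foldr-∪-⊆ (f ∘ Fin.suc) (f⊆ ∘ Fin.suc) ]′ (x∈p∪q⁻ (f Fin.zero) _ i∈)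

-- The left-hand side is the size of two nested sums of fan-in S over products
-- of two formulas of size t and an edge label.
size-step : ∀ S t → 2 ≤ S → 1 ≤ t → suc (S * suc (S * suc (t + suc (1 + t)))) ≤ S ^ 5 * t
size-step S t 2≤S 1≤t = begin
  suc (S * suc (S * A))           ≤⟨ absorb (suc (S * A)) ⟩
  S * (t + suc (S * A))           ≤⟨ ℕₚ.*-monoʳ-≤ S (ℕₚ.+-monoʳ-≤ t (absorb A)) ⟩
  S * (t + S * (t + A))           ≡⟨ cong (λ x → S * (x + S * (t + A))) (ℕₚ.*-identityˡ t) ⟨
  S * (1 * t + S * (t + A))       ≤⟨ ℕₚ.*-monoʳ-≤ S (ℕₚ.+-monoˡ-≤ (S * (t + A)) (ℕₚ.*-monoˡ-≤ t 1≤S)) ⟩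
  S * (S * t + S * (t + A))       ≡⟨ cong (S *_) (ℕₚ.*-distribˡ-+ S t (t + A)) ⟨
  S * (S * (t + (t + A)))         ≤⟨ ℕₚ.*-monoʳ-≤ S (ℕₚ.*-monoʳ-≤ S bound) ⟩
  S * (S * (S * (S * (S * t))))   ≡⟨ assoc S t ⟩
  S ^ 5 * t                       ∎
  where
  open ℕₚ.≤-Reasoning
  A = suc (t + suc (1 + t))

  1≤S : 1 ≤ S
  1≤S = ℕₚ.≤-trans (s≤s z≤n) 2≤S

  absorb : ∀ x → suc (S * x) ≤ S * (t + x)
  absorb x = begin
    1 + S * x      ≤⟨ ℕₚ.+-monoˡ-≤ (S * x) (ℕₚ.*-mono-≤ 1≤S 1≤t) ⟩
    S * t + S * x  ≡⟨ ℕₚ.*-distribˡ-+ S t x ⟨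
    S * (t + x)    ∎

  bound : t + (t + A) ≤ S * (S * (S * t))
  bound = begin
    t + (t + A)            ≡⟨ collect t ⟩
    3 * 1 + 4 * t          ≤⟨ ℕₚ.+-monoˡ-≤ (4 * t) (ℕₚ.*-mono-≤ {3} {4} (ℕₚ.n≤1+n 3) 1≤t) ⟩
    4 * t + 4 * t          ≡⟨ double t ⟩
    2 * (2 * (2 * t))      ≤⟨ ℕₚ.*-mono-≤ 2≤S (ℕₚ.*-mono-≤ 2≤S (ℕₚ.*-monoˡ-≤ t 2≤S)) ⟩
    S * (S * (S * t))      ∎
    where
    collect : ∀ t → t + (t + suc (t + suc (1 + t))) ≡ 3 * 1 + 4 * t
    collect = solve-∀
    double : ∀ t → 4 * t + 4 * t ≡ 2 * (2 * (2 * t))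
    double = solve-∀

  assoc : ∀ S t → S * (S * (S * (S * (S * t)))) ≡ S * (S * (S * (S * (S * 1)))) * t
  assoc = solve-∀

distinct⇒2≤ : ∀ {N} (i j : Fin N) → i ≢ j → 2 ≤ N
distinct⇒2≤ {suc zero}    Fin.zero Fin.zero i≢j = ⊥-elim (i≢j refl)
distinct⇒2≤ {suc (suc N)} _        _        _   = s≤s (s≤s z≤n)

-- The semiring of polynomials

module Polynomials {c ℓ₁ ℓ₂ : Level} (F : HeytingField c ℓ₁ ℓ₂) (n : ℕ) where

  open Programs F n

  private
    module F = CommutativeRing (HeytingCommutativeRing.commutativeRing (HeytingField.heytingCommutativeRing F))
    module F+ = CommutativeSemigroupProperties F.+-commutativeSemigroup
  open SetoidReasoning F.setoid

  infixl 7 _·_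
  _·_ : Monomial → Monomial → Monomial
  _·_ = zipWith _+_

  -- A polynomial is read as a finitely supported measure on monomials, and h as a test function.
  integral : Poly → (Monomial → F.Carrier) → F.Carrier
  integral []            h = F.0#
  integral ((a , k) ∷ p) h = a F.* h k F.+ integral p h

  -- Equality as linear functionals on functions of monomials.  It implies
  -- _≈ₚ_ (test on indicator functions), and, unlike for _≈ₚ_, congruence of
  -- the product is immediate.
  infix 4 _≋_
  record _≋_ (p q : Poly) : Set (c ⊔ˡ ℓ₁) where
    constructor functionally
    field
      integral≈ : ∀ h → integral p h F.≈ integral q h
  open _≋_ public

  integral-cong : ∀ p {h h′} → (∀ k → h k F.≈ h′ k) → integral p h F.≈ integral p h′
  integral-cong []            _  = F.refl
  integral-cong ((a , k) ∷ p) h≈ = F.+-cong (F.*-congˡ (h≈ k)) (integral-cong p h≈)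

  integral-0 : ∀ p → integral p (λ _ → F.0#) F.≈ F.0#
  integral-0 []            = F.refl
  integral-0 ((a , k) ∷ p) = F.trans (F.+-cong (F.zeroʳ a) (integral-0 p)) (F.+-identityˡ F.0#)

  integral-+ : ∀ p h h′ → integral p (λ k → h k F.+ h′ k) F.≈ integral p h F.+ integral p h′
  integral-+ []            h h′ = F.sym (F.+-identityˡ F.0#)
  integral-+ ((a , k) ∷ p) h h′ = F.trans
    (F.+-cong (F.distribˡ a (h k) (h′ k)) (integral-+ p h h′))
    (F+.interchange _ _ _ _)

  integral-++ : ∀ p q h → integral (p +ₚ q) h F.≈ integral p h F.+ integral q h
  integral-++ []            q h = F.sym (F.+-identityˡ _)
  integral-++ ((a , k) ∷ p) q h = F.trans (F.+-congˡ (integral-++ p q h)) (F.sym (F.+-assoc _ _ _))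

  -- Fubini: the product of polynomials is convolution of measures, so it integrates as an iterated
  -- integral. Associativity, units and distributivity of the product all reduce to this.
  integral-* : ∀ p q h → integral (p *ₚ q) h F.≈ integral p (λ k → integral q (λ l → h (k · l)))
  integral-* []            q h = F.refl
  integral-* ((a , k) ∷ p) q h =
    F.trans (integral-++ (map _ q) (p *ₚ q) h) (F.+-cong (term q) (integral-* p q h))
    where
    term : ∀ q → integral (map (λ t → a F.* proj₁ t , k · proj₂ t) q) h
                 F.≈ a F.* integral q (λ l → h (k · l))
    term []            = F.sym (F.zeroʳ a)
    term ((b , l) ∷ q) = F.trans (F.+-cong (F.*-assoc _ _ _) (term q)) (F.sym (F.distribˡ _ _ _))

  coeff-integral : ∀ p m →
    coeff p m F.≈ integral p (λ k → if does (≡-dec ℕ._≟_ k m) then F.1# else F.0#)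
  coeff-integral []            m = F.refl
  coeff-integral ((a , k) ∷ p) m = F.+-cong (indicator (does (≡-dec ℕ._≟_ k m))) (coeff-integral p m)
    where
    indicator : ∀ b → (if b then a else F.0#) F.≈ a F.* (if b then F.1# else F.0#)
    indicator true  = F.sym (F.*-identityʳ a)
    indicator false = F.sym (F.zeroʳ a)

  ≋⇒≈ₚ : ∀ {p q} → p ≋ q → p ≈ₚ q
  ≋⇒≈ₚ {p} {q} p≋q m =
    F.trans (coeff-integral p m) (F.trans (integral≈ p≋q _) (F.sym (coeff-integral q m)))

  ·-assoc : ∀ k l m → (k · l) · m ≡ k · (l · m)
  ·-assoc = zipWith-assoc ℕₚ.+-assoc

  -- Unlocks the library's exchange and distributivity laws for finite sums, on which
  -- `through-unfold` and `cut` rest.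
  polySemiring : Semiring c (c ⊔ˡ ℓ₁)
  polySemiring = record
    { Carrier = Poly ; _≈_ = _≋_ ; _+_ = _+ₚ_ ; _*_ = _*ₚ_ ; 0# = 0ₚ ; 1# = 1ₚ
    ; isSemiring = record
      { isSemiringWithoutAnnihilatingZero = record
        { +-isCommutativeMonoid = record
          { isMonoid = record
            { isSemigroup = record
              { isMagma = record { isEquivalence = ≋-isEquivalence ; ∙-cong = +-cong }
              ; assoc = +-assoc }
            ; identity = (λ p → functionally λ h → F.refl)
                       , (λ p → functionally λ h → F.trans (integral-++ p [] h) (F.+-identityʳ _)) }
          ; comm = +-comm }
        ; *-cong = *-cong
        ; *-assoc = *-assoc
        ; *-identity = *-identityˡ , *-identityʳ
        ; distrib = distribˡ , distribʳ }
      ; zero = (λ p → functionally λ h → F.refl)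
             , (λ p → functionally λ h → F.trans (integral-* p [] h) (integral-0 p)) } }
    where
    ≋-isEquivalence : IsEquivalence _≋_
    ≋-isEquivalence = record
      { refl  = functionally λ h → F.refl
      ; sym   = λ p≋q → functionally λ h → F.sym (integral≈ p≋q h)
      ; trans = λ p≋q q≋r → functionally λ h → F.trans (integral≈ p≋q h) (integral≈ q≋r h) }

    +-cong : ∀ {p p′ q q′} → p ≋ p′ → q ≋ q′ → p +ₚ q ≋ p′ +ₚ q′
    +-cong {p} {p′} {q} {q′} p≋ q≋ = functionally λ h → begin
      integral (p +ₚ q) h            ≈⟨ integral-++ p q h ⟩
      integral p h F.+ integral q h   ≈⟨ F.+-cong (integral≈ p≋ h) (integral≈ q≋ h) ⟩
      integral p′ h F.+ integral q′ h ≈⟨ integral-++ p′ q′ h ⟨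
      integral (p′ +ₚ q′) h          ∎

    +-assoc : ∀ p q r → (p +ₚ q) +ₚ r ≋ p +ₚ (q +ₚ r)
    +-assoc p q r = functionally λ h → begin
      integral ((p +ₚ q) +ₚ r) h                       ≈⟨ integral-++ (p +ₚ q) r h ⟩
      integral (p +ₚ q) h F.+ integral r h              ≈⟨ F.+-congʳ (integral-++ p q h) ⟩
      integral p h F.+ integral q h F.+ integral r h     ≈⟨ F.+-assoc _ _ _ ⟩
      integral p h F.+ (integral q h F.+ integral r h)   ≈⟨ F.+-congˡ (integral-++ q r h) ⟨
      integral p h F.+ integral (q +ₚ r) h              ≈⟨ integral-++ p (q +ₚ r) h ⟨
      integral (p +ₚ (q +ₚ r)) h                       ∎

    +-comm : ∀ p q → p +ₚ q ≋ q +ₚ p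
    +-comm p q = functionally λ h → begin
      integral (p +ₚ q) h          ≈⟨ integral-++ p q h ⟩
      integral p h F.+ integral q h ≈⟨ F.+-comm _ _ ⟩
      integral q h F.+ integral p h ≈⟨ integral-++ q p h ⟨
      integral (q +ₚ p) h          ∎

    *-cong : ∀ {p p′ q q′} → p ≋ p′ → q ≋ q′ → p *ₚ q ≋ p′ *ₚ q′
    *-cong {p} {p′} {q} {q′} p≋ q≋ = functionally λ h → begin
      integral (p *ₚ q) h                                ≈⟨ integral-* p q h ⟩
      integral p (λ k → integral q (λ l → h (k · l)))    ≈⟨ integral≈ p≋ _ ⟩
      integral p′ (λ k → integral q (λ l → h (k · l)))   ≈⟨ integral-cong p′ (λ k → integral≈ q≋ _) ⟩
      integral p′ (λ k → integral q′ (λ l → h (k · l)))  ≈⟨ integral-* p′ q′ h ⟨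
      integral (p′ *ₚ q′) h                              ∎

    *-assoc : ∀ p q r → (p *ₚ q) *ₚ r ≋ p *ₚ (q *ₚ r)
    *-assoc p q r = functionally λ h → begin
      integral ((p *ₚ q) *ₚ r) h
        ≈⟨ integral-* (p *ₚ q) r h ⟩
      integral (p *ₚ q) (λ k → integral r (λ m → h (k · m)))
        ≈⟨ integral-* p q _ ⟩
      integral p (λ k → integral q (λ l → integral r (λ m → h ((k · l) · m))))
        ≈⟨ integral-cong p (λ k → integral-cong q (λ l → integral-cong r (λ m →
             F.reflexive (cong h (·-assoc k l m))))) ⟩
      integral p (λ k → integral q (λ l → integral r (λ m → h (k · (l · m)))))
        ≈⟨ integral-cong p (λ k → integral-* q r _) ⟨
      integral p (λ k → integral (q *ₚ r) (λ l → h (k · l)))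
        ≈⟨ integral-* p (q *ₚ r) h ⟨
      integral (p *ₚ (q *ₚ r)) h ∎

    integral-1 : ∀ h → integral 1ₚ h F.≈ h (replicate n 0)
    integral-1 h = F.trans (F.+-identityʳ _) (F.*-identityˡ _)

    *-identityˡ : ∀ p → 1ₚ *ₚ p ≋ p
    *-identityˡ p = functionally λ h → begin
      integral (1ₚ *ₚ p) h                          ≈⟨ integral-* 1ₚ p h ⟩
      integral 1ₚ (λ k → integral p (λ l → h (k · l))) ≈⟨ integral-1 (λ k → integral p (λ l → h (k · l))) ⟩
      integral p (λ l → h (replicate n 0 · l))
        ≈⟨ integral-cong p (λ l → F.reflexive (cong h (zipWith-identityˡ ℕₚ.+-identityˡ l))) ⟩
      integral p h                                  ∎

    *-identityʳ : ∀ p → p *ₚ 1ₚ ≋ p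
    *-identityʳ p = functionally λ h → begin
      integral (p *ₚ 1ₚ) h                          ≈⟨ integral-* p 1ₚ h ⟩
      integral p (λ k → integral 1ₚ (λ l → h (k · l)))
        ≈⟨ integral-cong p (λ k → F.trans (integral-1 (λ l → h (k · l)))
             (F.reflexive (cong h (zipWith-identityʳ ℕₚ.+-identityʳ k)))) ⟩
      integral p h                                  ∎

    distribˡ : ∀ p q r → p *ₚ (q +ₚ r) ≋ p *ₚ q +ₚ p *ₚ r
    distribˡ p q r = functionally λ h → begin
      integral (p *ₚ (q +ₚ r)) h
        ≈⟨ integral-* p (q +ₚ r) h ⟩
      integral p (λ k → integral (q +ₚ r) (λ l → h (k · l)))
        ≈⟨ integral-cong p (λ k → integral-++ q r _) ⟩
      integral p (λ k → integral q (λ l → h (k · l)) F.+ integral r (λ l → h (k · l)))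
        ≈⟨ integral-+ p _ _ ⟩
      integral p (λ k → integral q (λ l → h (k · l))) F.+ integral p (λ k → integral r (λ l → h (k · l)))
        ≈⟨ F.+-cong (integral-* p q h) (integral-* p r h) ⟨
      integral (p *ₚ q) h F.+ integral (p *ₚ r) h
        ≈⟨ integral-++ (p *ₚ q) (p *ₚ r) h ⟨
      integral (p *ₚ q +ₚ p *ₚ r) h ∎

    distribʳ : ∀ p q r → (q +ₚ r) *ₚ p ≋ q *ₚ p +ₚ r *ₚ p
    distribʳ p q r = functionally λ h → begin
      integral ((q +ₚ r) *ₚ p) h
        ≈⟨ integral-* (q +ₚ r) p h ⟩
      integral (q +ₚ r) (λ k → integral p (λ l → h (k · l)))
        ≈⟨ integral-++ q r _ ⟩
      integral q (λ k → integral p (λ l → h (k · l))) F.+ integral r (λ k → integral p (λ l → h (k · l)))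
        ≈⟨ F.+-cong (integral-* q p h) (integral-* r p h) ⟨
      integral (q *ₚ p) h F.+ integral (r *ₚ p) h
        ≈⟨ integral-++ (q *ₚ p) (r *ₚ p) h ⟨
      integral (q *ₚ p +ₚ r *ₚ p) h ∎

-- Enumeration of paths and path polynomials

module Paths {c ℓ₁ ℓ₂ : Level} (F : HeytingField c ℓ₁ ℓ₂) (n : ℕ) where

  open Programs F n
  open Polynomials F n

  private
    module F = CommutativeRing (HeytingCommutativeRing.commutativeRing (HeytingField.heytingCommutativeRing F))
    module R = Semiring polySemiring
  open SemiringSum polySemiring renaming (sum to ∑)
  open SetoidReasoning R.setoid

  module _ {N : ℕ} where

    -- A copy, under a global name, of the function local to `pathsOfLength`; with `e` as a separate
    -- argument it can be analysed by cases.
    extensions : (E : Edges N) → ℕ → ∀ u v w (e : Maybe Label) → E u w ≡ e → List (Path E u v)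
    extensions E k u v w (just a) eq = map (step eq) (pathsOfLength E k w v)
    extensions E k u v w nothing  eq = []

    -- The local function of `pathsOfLength` cannot be named, so `refl` lets unification find it,
    -- and `proj₁` then refers to it.
    pathsVia : (E : Edges N) (k : ℕ) (u v : Fin N) →
      Σ[ g ∈ (Fin N → List (Path E u v)) ] pathsOfLength E (suc k) u v ≡ concatMap g (allFin N)
    pathsVia E k u v = _ , refl

    -- The enumeration in pathsOfLength scrutinises E u w together with a proof
    -- refl : E u w ≡ E u w, of which only the right-hand side may be
    -- generalised.  Since E z u w is E tt u w only up to η for ⊤, the
    -- left-hand side is protected from the with-abstraction.
    pathsVia≡extensions : (E : ⊤ → Edges N) (z : ⊤) (k : ℕ) (u v w : Fin N) →
      proj₁ (pathsVia (E tt) k u v) w ≡ extensions (E tt) k u v w (E tt u w) refl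
    pathsVia≡extensions E z k u v w with E tt u w | (E z u w ≡ E tt u w) ∋ refl
    ... | just a  | _ = refl
    ... | nothing | _ = refl

    pathsOfLength-suc : (E : Edges N) (k : ℕ) (u v : Fin N) →
      pathsOfLength E (suc k) u v ≡ concatMap (λ w → extensions E k u v w (E u w) refl) (allFin N)
    pathsOfLength-suc E k u v = Listₚ.concatMap-cong (pathsVia≡extensions (λ _ → E) tt k u v) (allFin N)

  variables : List Label → List (Fin n)
  variables []             = []
  variables (var i ∷ as)   = i ∷ variables as
  variables (const _ ∷ as) = variables as

  variables-++ : ∀ as bs → variables (as ++ bs) ≡ variables as ++ variables bs
  variables-++ []             bs = refl
  variables-++ (var i ∷ as)   bs = cong (i ∷_) (variables-++ as bs)
  variables-++ (const _ ∷ as) bs = variables-++ as bs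

  termProduct : HeytingField.Carrier F × Monomial → HeytingField.Carrier F × Monomial → HeytingField.Carrier F × Monomial
  termProduct s t = proj₁ s F.* proj₁ t , proj₂ s · proj₂ t

  -- Absent edges become 0, so that a sum over successors can range over all nodes: these are the
  -- entries of the adjacency matrix.
  edgePoly : Maybe Label → Poly
  edgePoly = maybe′ labelPoly 0ₚ

  module _ {N : ℕ} (E : Edges N) where

    pathVars≡variables : ∀ {u v} (p : Path E u v) → pathVars E p ≡ variables (labels E p)
    pathVars≡variables []                       = refl
    pathVars≡variables (step {a = var i} _ p)   = cong (i ∷_) (pathVars≡variables p)
    pathVars≡variables (step {a = const _} _ p) = pathVars≡variables p

    infixr 5 _⊕_
    _⊕_ : ∀ {u v w} → Path E u v → Path E v w → Path E u w
    []        ⊕ q = q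
    step eq p ⊕ q = step eq (p ⊕ q)

    labels-⊕ : ∀ {u v w} (p : Path E u v) (q : Path E v w) → labels E (p ⊕ q) ≡ labels E p ++ labels E q
    labels-⊕ []                 q = refl
    labels-⊕ (step {a = a} _ p) q = cong (a ∷_) (labels-⊕ p q)

    pathVars-⊕ : ∀ {u v w} (p : Path E u v) (q : Path E v w) → pathVars E (p ⊕ q) ≡ pathVars E p ++ pathVars E q
    pathVars-⊕ p q
      rewrite pathVars≡variables (p ⊕ q) | pathVars≡variables p | pathVars≡variables q | labels-⊕ p q
      = variables-++ (labels E p) (labels E q)

    pathLength : ∀ {u v} → Path E u v → ℕ
    pathLength []         = 0
    pathLength (step _ p) = suc (pathLength p)

    ∈-pathsOfLength : ∀ {u v} (p : Path E u v) → p List.∈ pathsOfLength E (pathLength p) u v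
    ∈-pathsOfLength {u} [] with u Fin.≟ u
    ... | yes refl = here refl
    ... | no u≢u   = ⊥-elim (u≢u refl)
    ∈-pathsOfLength {u} {v} (step {w = w} eq p) =
      subst (_ List.∈_) (≡.sym (pathsOfLength-suc E k u v))
        (∈-concatMap⁺ (λ w → extensions E k u v w (E u w) refl)
          (List.lose (∈-allFin w) (subst (_ List.∈_) (≡.sym (extensions-subst eq)) (∈-map⁺ (step eq) (∈-pathsOfLength p)))))
      where
      k = pathLength p
      extensions-subst : ∀ {e} (eq : E u w ≡ e) → extensions E k u v w (E u w) refl ≡ extensions E k u v w e eq
      extensions-subst refl = refl

    totalWeight : ∀ {u v} → List (Path E u v) → Poly
    totalWeight ps = foldr _+ₚ_ 0ₚ (map (weight E) ps)

    totalWeight-++ : ∀ {u v} (ps qs : List (Path E u v)) →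
      totalWeight (ps ++ qs) ≋ totalWeight ps +ₚ totalWeight qs
    totalWeight-++ []       qs = R.refl
    totalWeight-++ (p ∷ ps) qs = R.trans (R.+-congˡ (totalWeight-++ ps qs)) (R.sym (R.+-assoc (weight E p) _ _))

    totalWeight-map-step : ∀ {u v w a} (eq : E u w ≡ just a) (ps : List (Path E w v)) →
      totalWeight (map (step eq) ps) ≋ labelPoly a *ₚ totalWeight ps
    totalWeight-map-step {a = a} eq []       = R.sym (R.zeroʳ (labelPoly a))
    totalWeight-map-step {a = a} eq (p ∷ ps) =
      R.trans (R.+-congˡ (totalWeight-map-step eq ps)) (R.sym (R.distribˡ (labelPoly a) (weight E p) _))

    totalWeight-concatMap-tabulate : ∀ {u v m} {A : Set} (g : A → List (Path E u v)) (f : Fin m → A) →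
      totalWeight (concatMap g (tabulate f)) ≋ ∑ (λ i → totalWeight (g (f i)))
    totalWeight-concatMap-tabulate {m = zero}  g f = R.refl
    totalWeight-concatMap-tabulate {m = suc m} g f =
      R.trans (totalWeight-++ (g (f Fin.zero)) _) (R.+-congˡ (totalWeight-concatMap-tabulate g (f ∘ Fin.suc)))

    totalWeight-extensions : ∀ k u v w e (eq : E u w ≡ e) →
      totalWeight (extensions E k u v w e eq) ≋ edgePoly e *ₚ totalWeight (pathsOfLength E k w v)
    totalWeight-extensions k u v w (just a) eq = totalWeight-map-step eq (pathsOfLength E k w v)
    totalWeight-extensions k u v w nothing  eq = R.refl

    walkPoly : ℕ → Fin N → Fin N → Poly
    walkPoly k u v = totalWeight (pathsOfLength E k u v)

    walkPoly-suc : ∀ k u v → walkPoly (suc k) u v ≋ ∑ (λ w → edgePoly (E u w) *ₚ walkPoly k w v)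
    walkPoly-suc k u v = begin
      totalWeight (pathsOfLength E (suc k) u v)
        ≡⟨ cong totalWeight (pathsOfLength-suc E k u v) ⟩
      totalWeight (concatMap (λ w → extensions E k u v w (E u w) refl) (allFin N))
        ≈⟨ totalWeight-concatMap-tabulate (λ w → extensions E k u v w (E u w) refl) id ⟩
      ∑ (λ w → totalWeight (extensions E k u v w (E u w) refl))
        ≈⟨ sum-cong-≋ (λ w → totalWeight-extensions k u v w (E u w) refl) ⟩
      ∑ (λ w → edgePoly (E u w) *ₚ walkPoly k w v) ∎

    walkPolys : List ℕ → Fin N → Fin N → Poly
    walkPolys ks u v = totalWeight (concatMap (λ k → pathsOfLength E k u v) ks)

    -- For `upTo` alone the induction would not close, since `applyUpTo` changes its function at
    -- each step; hence the general `f`.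
    walkPolys-suc : ∀ f d u v →
      walkPolys (applyUpTo (suc ∘ f) d) u v ≋ ∑ (λ w → edgePoly (E u w) *ₚ walkPolys (applyUpTo f d) w v)
    walkPolys-suc f zero u v = R.sym (begin
      ∑ (λ w → edgePoly (E u w) *ₚ 0ₚ) ≈⟨ sum-cong-≋ (λ w → R.zeroʳ (edgePoly (E u w))) ⟩
      ∑ {N} (λ _ → 0ₚ)                 ≈⟨ sum-replicate-zero N ⟩
      0ₚ                                 ∎)
    walkPolys-suc f (suc d) u v = begin
      walkPolys (suc (f 0) ∷ applyUpTo (suc ∘ f ∘ suc) d) u v
        ≈⟨ totalWeight-++ (pathsOfLength E (suc (f 0)) u v) _ ⟩
      walkPoly (suc (f 0)) u v +ₚ walkPolys (applyUpTo (suc ∘ f ∘ suc) d) u v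
        ≈⟨ R.+-cong (walkPoly-suc (f 0) u v) (walkPolys-suc (f ∘ suc) d u v) ⟩
      ∑ (λ w → edgePoly (E u w) *ₚ walkPoly (f 0) w v) +ₚ ∑ (λ w → edgePoly (E u w) *ₚ walkPolys (applyUpTo (f ∘ suc) d) w v)
        ≈⟨ ∑-distrib-+ (λ w → edgePoly (E u w) *ₚ walkPoly (f 0) w v) _ ⟨
      ∑ (λ w → edgePoly (E u w) *ₚ walkPoly (f 0) w v +ₚ edgePoly (E u w) *ₚ walkPolys (applyUpTo (f ∘ suc) d) w v)
        ≈⟨ sum-cong-≋ (λ w → R.trans
             (R.*-congˡ {edgePoly (E u w)} (totalWeight-++ (pathsOfLength E (f 0) w v) _))
             (R.distribˡ (edgePoly (E u w)) (walkPoly (f 0) w v) _)) ⟨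
      ∑ (λ w → edgePoly (E u w) *ₚ walkPolys (applyUpTo f (suc d)) w v) ∎

    pathPoly-unfold : ∀ d u v →
      pathPoly E (suc d) u v ≋ walkPoly 0 u v +ₚ ∑ (λ w → edgePoly (E u w) *ₚ pathPoly E d w v)
    pathPoly-unfold d u v = R.trans
      (totalWeight-++ (pathsOfLength E 0 u v) _)
      (R.+-congˡ (walkPolys-suc id (suc d) u v))

    pathPoly-suc : ∀ d u v → pathPoly E (suc d) u v ≋ pathPoly E d u v +ₚ walkPoly (suc d) u v
    pathPoly-suc d u v = begin
      walkPolys (upTo (2 + d)) u v
        ≡⟨ cong (λ ks → walkPolys ks u v) (Listₚ.upTo-∷ʳ (suc d)) ⟨
      walkPolys (upTo (suc d) ∷ʳ suc d) u v
        ≡⟨ cong totalWeight (Listₚ.concatMap-++ (λ k → pathsOfLength E k u v) (upTo (suc d)) _) ⟩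
      totalWeight (paths E d u v ++ (pathsOfLength E (suc d) u v ++ []))
        ≡⟨ cong (λ ps → totalWeight (paths E d u v ++ ps)) (Listₚ.++-identityʳ (pathsOfLength E (suc d) u v)) ⟩
      totalWeight (paths E d u v ++ pathsOfLength E (suc d) u v)
        ≈⟨ totalWeight-++ (paths E d u v) _ ⟩
      pathPoly E d u v +ₚ walkPoly (suc d) u v ∎

    -- This and the next lemma make `walkPoly 0` the identity matrix.
    walkPoly-0-refl : ∀ u → walkPoly 0 u u ≋ 1ₚ
    walkPoly-0-refl u with u Fin.≟ u
    ... | yes refl = R.+-identityʳ 1ₚ
    ... | no  u≢u  = ⊥-elim (u≢u refl)

    walkPoly-0-≢ : ∀ {u v} → u ≢ v → walkPoly 0 u v ≋ 0ₚ
    walkPoly-0-≢ {u} {v} u≢v with u Fin.≟ v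
    ... | yes u≡v = ⊥-elim (u≢v u≡v)
    ... | no _    = R.refl

    -- The second conjunct carries the induction: at a step labelled by `j`, uniqueness keeps `j`
    -- off the rest of the path, so its exponent there is 0 and becomes exactly 1.
    weight-exponents : ∀ {u v} (p : Path E u v) → Unique (pathVars E p) → ∀ {a m} → (a , m) List.∈ weight E p →
      ∀ i → lookup m i ≤ 1 × (0 < lookup m i → i List.∈ pathVars E p)
    weight-exponents [] _ (here refl) i rewrite lookup-replicate i 0 = z≤n , λ ()
    weight-exponents (step {a = const b} _ p) uniq t∈ i
      with ∈-cartesianProductWith⁻ termProduct (constₚ b) (weight E p) t∈
    ... | _ , (_ , m) , here refl , t∈p , refl
      rewrite lookup-zipWith _+_ i (replicate n 0) m | lookup-replicate i 0
      = weight-exponents p uniq t∈p i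
    weight-exponents (step {a = var j} _ p) (j∉ ∷ uniq) t∈ i
      with ∈-cartesianProductWith⁻ termProduct (varₚ j) (weight E p) t∈
    ... | _ , (_ , m) , here refl , t∈p , refl
      rewrite lookup-zipWith _+_ i (replicate n 0 [ j ]≔ 1) m
      with weight-exponents p uniq t∈p i | i Fin.≟ j
    ... | m≤1 , m>0⇒∈ | no i≢j
      rewrite lookup∘update′ i≢j (replicate n 0) 1 | lookup-replicate i 0
      = m≤1 , there ∘ m>0⇒∈
    ... | m≤1 , m>0⇒∈ | yes refl
      rewrite lookup∘update i (replicate n 0) 1
      = s≤s (ℕₚ.≮⇒≥ (λ m>0 → All.lookup j∉ (m>0⇒∈ m>0) refl)) , λ _ → here refl

    totalWeight-terms : ∀ {u v} (ps : List (Path E u v)) {t} → t List.∈ totalWeight ps →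
      Σ[ p ∈ Path E u v ] t List.∈ weight E p
    totalWeight-terms {u} {v} (p ∷ ps) t∈ with ∈-++⁻ (weight E p) t∈
    ... | inj₁ t∈p  = p , t∈p
    ... | inj₂ t∈ps = totalWeight-terms {u} {v} ps t∈ps

  coeff-absent : ∀ p m → (∀ {a k} → (a , k) List.∈ p → k ≢ m) → coeff p m F.≈ F.0#
  coeff-absent []            m _ = F.refl
  coeff-absent ((a , k) ∷ p) m k≢m with ≡-dec ℕ._≟_ k m
  ... | yes k≡m = ⊥-elim (k≢m (here refl) k≡m)
  ... | no _    = F.trans (F.+-identityˡ _) (coeff-absent p m (k≢m ∘ there))

-- Blocks of a layered program and their variables

module Program {c ℓ₁ ℓ₂ : Level} (F : HeytingField c ℓ₁ ℓ₂) (n : ℕ)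
  (P : Programs.ABP F n) (P-multilinear : Programs.ABP.SyntacticMultilinear P) where

  open Programs F n
  open Polynomials F n
  open Paths F n
  open ABP P

  private
    module R = Semiring polySemiring
  open SemiringSum polySemiring renaming (sum to ∑)

  G : Fin size → Fin size → Poly
  G = pathPoly edge ℓ

  X : Fin size → Fin size → Subset n
  X = varsBetween edge ℓ

  depth : Fin size → ℕ
  depth u = toℕ (layer u)

  depth≤ℓ : ∀ u → depth u ≤ ℓ
  depth≤ℓ u = ℕₚ.≤-pred (Finₚ.toℕ<n (layer u))

  depth-path : ∀ {u v} (p : Path edge u v) → depth v ≡ pathLength edge p + depth u
  depth-path []          = refl
  depth-path (step eq p) =
    ≡.trans (depth-path p) (≡.trans (cong (pathLength edge p +_) (edge-layer eq)) (ℕₚ.+-suc _ _))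

  ∈-paths : ∀ {u v} (p : Path edge u v) → p List.∈ paths edge ℓ u v
  ∈-paths {u} {v} p = ∈-concatMap⁺ (λ k → pathsOfLength edge k u v)
    (List.lose (∈-upTo⁺ (s≤s length≤ℓ)) (∈-pathsOfLength edge p))
    where
    length≤ℓ : pathLength edge p ≤ ℓ
    length≤ℓ = ℕₚ.≤-trans (ℕₚ.m≤m+n _ (depth u)) (subst (_≤ ℓ) (depth-path p) (depth≤ℓ v))

  path? : ∀ u v → Dec (Path edge u v)
  path? u v with paths edge ℓ u v in eq
  ... | p ∷ _ = yes p
  ... | []    = no λ p → absurd (subst (p List.∈_) eq (∈-paths p))
    where
    absurd : ∀ {p : Path edge u v} → ¬ p List.∈ []
    absurd ()

  edge? : ∀ u v → Dec (∃[ a ] edge u v ≡ just a)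
  edge? u v with edge u v
  ... | just a  = yes (a , refl)
  ... | nothing = no λ ()

  no-descending-path : ∀ {u w} → depth w < depth u → ¬ Path edge u w
  no-descending-path {u} w<u p = ℕₚ.<⇒≱ w<u (subst (depth u ≤_) (≡.sym (depth-path p)) (ℕₚ.m≤n+m (depth u) _))

  path-level : ∀ {u w} → depth w ≡ depth u → Path edge u w → u ≡ w
  path-level _   [] = refl
  path-level w≡u (step {w = y} eq p) =
    ⊥-elim (no-descending-path (subst (_< depth y) (≡.sym w≡u) (ℕₚ.≤-reflexive (≡.sym (edge-layer eq)))) p)

  unreachable : ∀ {u v} → ¬ Path edge u v → G u v ≋ 0ₚ
  unreachable {u} {v} ¬p with paths edge ℓ u v
  ... | []    = R.refl
  ... | p ∷ _ = ⊥-elim (¬p p)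

  ∑-zero : ∀ {m} (f : Fin m → Poly) → (∀ i → f i ≋ 0ₚ) → ∑ f ≋ 0ₚ
  ∑-zero {m} f f≋0 = R.trans (sum-cong-≋ f≋0) (sum-replicate-zero m)

  ∑-single : ∀ {m} (j : Fin m) (f : Fin m → Poly) → (∀ i → i ≢ j → f i ≋ 0ₚ) → ∑ f ≋ f j
  ∑-single Fin.zero    f f≋0 = R.trans
    (R.+-congˡ (∑-zero (f ∘ Fin.suc) (λ i → f≋0 (Fin.suc i) λ ())))
    (R.+-identityʳ (f Fin.zero))
  ∑-single (Fin.suc j) f f≋0 = R.trans
    (R.+-congʳ (f≋0 Fin.zero λ ()))
    (∑-single j (f ∘ Fin.suc) (λ i i≢j → f≋0 (Fin.suc i) (i≢j ∘ Finₚ.suc-injective)))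

  -- Each edge raises the depth by one, so `k + depth u` stays the same while `k` falls; at `k = 0`
  -- it contradicts `depth≤ℓ`.
  walkPoly-vanishes : ∀ k u v → ℓ < k + depth u → walkPoly edge k u v ≋ 0ₚ
  walkPoly-vanishes zero    u v ℓ< = ⊥-elim (ℕₚ.<⇒≱ ℓ< (depth≤ℓ u))
  walkPoly-vanishes (suc k) u v ℓ< = R.trans (walkPoly-suc edge k u v) (∑-zero _ term)
    where
    term : ∀ w → edgePoly (edge u w) *ₚ walkPoly edge k w v ≋ 0ₚ
    term w with edge u w in eq
    ... | nothing = R.refl
    ... | just a  = R.trans
      (R.*-congˡ {labelPoly a} (walkPoly-vanishes k w v
        (subst (ℓ <_) (≡.trans (≡.sym (ℕₚ.+-suc k (depth u))) (cong (k +_) (≡.sym (edge-layer eq)))) ℓ<)))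
      (R.zeroʳ (labelPoly a))

  -- As matrices, G = I + E G. A first step lowers the length bound by one; as walks of length ℓ+1
  -- vanish in a layered graph, the same bound ℓ can stand on both sides.
  G-unfold : ∀ u v → G u v ≋ walkPoly edge 0 u v +ₚ ∑ (λ w → edgePoly (edge u w) *ₚ G w v)
  G-unfold u v = begin
    G u v                                   ≈⟨ R.+-identityʳ (G u v) ⟨
    G u v +ₚ 0ₚ                             ≈⟨ R.+-congˡ (walkPoly-vanishes (suc ℓ) u v (ℕₚ.m≤m+n (suc ℓ) _)) ⟨
    G u v +ₚ walkPoly edge (suc ℓ) u v      ≈⟨ pathPoly-suc edge ℓ u v ⟨
    pathPoly edge (suc ℓ) u v               ≈⟨ pathPoly-unfold edge ℓ u v ⟩
    walkPoly edge 0 u v +ₚ ∑ (λ w → edgePoly (edge u w) *ₚ G w v) ∎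
    where open SetoidReasoning R.setoid

  G-refl : ∀ u → G u u ≋ 1ₚ
  G-refl u = begin
    G u u ≈⟨ G-unfold u u ⟩
    walkPoly edge 0 u u +ₚ ∑ (λ w → edgePoly (edge u w) *ₚ G w u)
      ≈⟨ R.+-cong (walkPoly-0-refl edge u) (∑-zero _ term) ⟩
    1ₚ +ₚ 0ₚ ≈⟨ R.+-identityʳ 1ₚ ⟩
    1ₚ ∎
    where
    open SetoidReasoning R.setoid
    term : ∀ w → edgePoly (edge u w) *ₚ G w u ≋ 0ₚ
    term w with edge u w in eq
    ... | nothing = R.refl
    ... | just a  = R.trans
      (R.*-congˡ {labelPoly a} (unreachable (no-descending-path (ℕₚ.≤-reflexive (≡.sym (edge-layer eq))))))
      (R.zeroʳ (labelPoly a))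

  -- Layering leaves the edge as the only path from `u` to `v`. So an edge label is itself a block
  -- and may serve as a leaf.
  G-edge : ∀ {u v a} → edge u v ≡ just a → G u v ≋ edgePoly (edge u v)
  G-edge {u} {v} uv = begin
    G u v ≈⟨ G-unfold u v ⟩
    walkPoly edge 0 u v +ₚ ∑ (λ w → edgePoly (edge u w) *ₚ G w v)
      ≈⟨ R.+-cong (walkPoly-0-≢ edge u≢v) (∑-single v _ term) ⟩
    0ₚ +ₚ edgePoly (edge u v) *ₚ G v v
      ≈⟨ R.*-congˡ {edgePoly (edge u v)} (G-refl v) ⟩
    edgePoly (edge u v) *ₚ 1ₚ
      ≈⟨ R.*-identityʳ (edgePoly (edge u v)) ⟩
    edgePoly (edge u v) ∎
    where
    open SetoidReasoning R.setoid
    u≢v : u ≢ v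
    u≢v u≡v = ℕₚ.1+n≢n (≡.trans (≡.sym (edge-layer uv)) (cong depth (≡.sym u≡v)))
    term : ∀ w → w ≢ v → edgePoly (edge u w) *ₚ G w v ≋ 0ₚ
    term w w≢v with edge u w in uw
    ... | nothing = R.refl
    ... | just a  = R.trans
      (R.*-congˡ {labelPoly a} (unreachable (w≢v ∘ path-level (≡.trans (edge-layer uv) (≡.sym (edge-layer uw))))))
      (R.zeroʳ (labelPoly a))

  no-edge : ∀ {u v} → ¬ (∃[ a ] edge u v ≡ just a) → edge u v ≡ nothing
  no-edge {u} {v} ¬e with edge u v
  ... | just a  = ⊥-elim (¬e (a , refl))
  ... | nothing = refl

  -- Going backwards along edges lowers the depth and can only stop at a node of in-degree 0, which
  -- is the source.
  from-source : ∀ v → Path edge source v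
  from-source v = go (depth v) v ℕₚ.≤-refl
    where
    go : ∀ m v → depth v ≤ m → Path edge source v
    go m v v≤m with Finₚ.any? (λ u → edge? u v)
    ... | no  ¬e = subst (Path edge source) (≡.sym v≡source) []
      where
      v≡source : v ≡ source
      v≡source = Equivalence.to (sole-source v) (λ u → no-edge (¬e ∘ (u ,_)))
    go zero    v v≤m | yes (u , a , uv) = ⊥-elim (ℕₚ.n≮0 (subst (_≤ 0) (edge-layer uv) v≤m))
    go (suc m) v v≤m | yes (u , a , uv) =
      _⊕_ edge (go m u (ℕₚ.≤-pred (subst (_≤ suc m) (edge-layer uv) v≤m))) (step uv [])

  to-sink : ∀ v → Path edge v sink
  to-sink v = go ℓ v (ℕₚ.m≤n+m ℓ _)
    where
    go : ∀ m v → ℓ ≤ depth v + m → Path edge v sink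
    go m v ℓ≤ with Finₚ.any? (edge? v)
    ... | no ¬e = subst (Path edge v) v≡sink []
      where
      v≡sink : v ≡ sink
      v≡sink = Equivalence.to (sole-sink v) (λ w → no-edge (¬e ∘ (w ,_)))
    go zero v ℓ≤ | yes (w , a , vw) = ⊥-elim (ℕₚ.<⇒≱ (subst (_≤ ℓ) (edge-layer vw) (depth≤ℓ w))
      (subst (ℓ ≤_) (ℕₚ.+-identityʳ _) ℓ≤))
    go (suc m) v ℓ≤ | yes (w , a , vw) =
      step vw (go m w (subst (ℓ ≤_) (≡.trans (ℕₚ.+-suc (depth v) m) (cong (_+ m) (≡.sym (edge-layer vw)))) ℓ≤))

  -- Multilinearity is assumed for source-to-sink paths; `p` is a contiguous part of one, since
  -- every node is reachable from the source and reaches the sink.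
  path-unique : ∀ {u v} (p : Path edge u v) → Unique (pathVars edge p)
  path-unique {u} {v} p =
    Unique-++⁻ˡ (pathVars edge p)
      (subst Unique (pathVars-⊕ edge p b)
        (Unique-++⁻ʳ (pathVars edge a)
          (subst Unique (pathVars-⊕ edge a (_⊕_ edge p b)) (P-multilinear (_⊕_ edge a (_⊕_ edge p b))))))
    where
    a = from-source u
    b = to-sink v

  G-multilinear : ∀ u v → Multilinear (G u v)
  G-multilinear u v m i 2≤ = coeff-absent (G u v) m λ t∈ k≡m →
    let p , t∈p = totalWeight-terms edge (paths edge ℓ u v) t∈
    in ℕₚ.<⇒≱ 2≤ (subst (λ k → lookup k i ≤ 1) k≡m (proj₁ (weight-exponents edge p (path-unique p) t∈p i)))

  ∈-X⁺ : ∀ {u v i} (p : Path edge u v) → i List.∈ pathVars edge p → i ∈ X u v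
  ∈-X⁺ p i∈p = ∈-⋃-map⁺ _ (∈-paths p) (∈-⋃-map⁺ ⁅_⁆ i∈p (x∈⁅x⁆ _))

  ∈-X⁻ : ∀ u v {i} → i ∈ X u v → Σ[ p ∈ Path edge u v ] i List.∈ pathVars edge p
  ∈-X⁻ u v i∈X with ∈-⋃-map⁻ _ (paths edge ℓ u v) i∈X
  ... | p , _ , i∈p with ∈-⋃-map⁻ ⁅_⁆ (pathVars edge p) i∈p
  ...   | j , j∈p , i∈j rewrite x∈⁅y⁆⇒x≡y j i∈j = p , j∈p

  X-monoʳ : ∀ u {v w} → Path edge v w → X u v ⊆ X u w
  X-monoʳ u {v} q i∈ with ∈-X⁻ u v i∈
  ... | p , i∈p = ∈-X⁺ (_⊕_ edge p q) (subst (_ List.∈_) (≡.sym (pathVars-⊕ edge p q)) (∈-++⁺ˡ i∈p))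

  X-monoˡ : ∀ {u v} w → Path edge u v → X v w ⊆ X u w
  X-monoˡ {v = v} w p i∈ with ∈-X⁻ v w i∈
  ... | q , i∈q = ∈-X⁺ (_⊕_ edge p q) (subst (_ List.∈_) (≡.sym (pathVars-⊕ edge p q)) (∈-++⁺ʳ (pathVars edge p) i∈q))

  -- Witnessing paths for the two memberships concatenate to one path, on which the variable would
  -- occur twice.
  X-disjoint : ∀ u v w {i} → i ∈ X u v → ¬ i ∈ X v w
  X-disjoint u v w i∈uv i∈vw with ∈-X⁻ u v i∈uv | ∈-X⁻ v w i∈vw
  ... | p , i∈p | q , i∈q =
    Unique-++⁻-disjoint (subst Unique (pathVars-⊕ edge p q) (path-unique (_⊕_ edge p q))) i∈p i∈q

  ∣X∣-split : ∀ {u v w} → Path edge u v → Path edge v w → ∣ X u v ∣ + ∣ X v w ∣ ≤ ∣ X u w ∣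
  ∣X∣-split {u} {v} {w} p q = ℕₚ.≤-trans
    (∣p∣+∣q∣≤∣p∪q∣ (X u v) (X v w) λ { (i , i∈) →
      let i∈uv , i∈vw = x∈p∩q⁻ (X u v) (X v w) i∈ in X-disjoint u v w i∈uv i∈vw })
    (p⊆q⇒∣p∣≤∣q∣ {q = X u w} (λ i∈ → [ X-monoʳ u q , X-monoˡ w p ]′ (x∈p∪q⁻ (X u v) (X v w) i∈)))

  ∣X∣-edge : ∀ {u v a} → edge u v ≡ just a → ∣ X u v ∣ ≤ 1
  ∣X∣-edge {u} {v} {a} uv = ℕₚ.≤-trans (p⊆q⇒∣p∣≤∣q∣ {p = X u v} X⊆) (∣labelVars∣≤1 a)
    where
    labelVars : Label → Subset n
    labelVars (var i)   = ⁅ i ⁆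
    labelVars (const _) = ⊥

    ∣labelVars∣≤1 : ∀ a → ∣ labelVars a ∣ ≤ 1
    ∣labelVars∣≤1 (var i)   = ℕₚ.≤-reflexive (∣⁅x⁆∣≡1 i)
    ∣labelVars∣≤1 (const _) = subst (_≤ 1) (≡.sym (∣⊥∣≡0 n)) z≤n

    single : ∀ {i} a → i List.∈ variables (a ∷ []) → i ∈ labelVars a
    single (var j) (here refl) = x∈⁅x⁆ j

    labels≡ : (p : Path edge u v) → labels edge p ≡ a ∷ []
    labels≡ [] = ⊥-elim (ℕₚ.1+n≢n (≡.sym (edge-layer uv)))
    labels≡ (step uw p) with path-level (≡.trans (edge-layer uv) (≡.sym (edge-layer uw))) p
    labels≡ (step uw []) | refl = cong (_∷ []) (Maybeₚ.just-injective (≡.trans (≡.sym uw) uv))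
    labels≡ (step uw (step wy p)) | refl =
      ⊥-elim (no-descending-path (ℕₚ.≤-reflexive (≡.sym (edge-layer wy))) p)

    X⊆ : X u v ⊆ labelVars a
    X⊆ i∈ with ∈-X⁻ u v i∈
    ... | p , i∈p = single a (subst (λ as → _ List.∈ variables as) (labels≡ p)
      (subst (_ List.∈_) (pathVars≡variables edge p) i∈p))

  -- Cutting a block at a threshold

  module Cut (u v : Fin size) (t : ℕ) where

    Low : Fin size → Set
    Low w = ∣ X u w ∣ < t

    low? : ∀ w → Dec (Low w)
    low? w = ∣ X u w ∣ ℕ.<? t

    -- The two paths ensure that all three factors have their variables inside `X u v` and that
    -- `∣X∣-split` bounds the last one. Pairs without them contribute 0.
    Crossing : Fin size → Fin size → Set c
    Crossing w w′ = Path edge u w × Low w × (∃[ a ] edge w w′ ≡ just a) × ¬ Low w′ × Path edge w′ v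

    crossing? : ∀ w w′ → Dec (Crossing w w′)
    crossing? w w′ = path? u w ×-dec low? w ×-dec edge? w w′ ×-dec ¬? (low? w′) ×-dec path? w′ v

    -- Takes the decision as an argument, so that one case split on it later fixes both the
    -- polynomial and the formula of a summand.
    afterCut : ∀ {w w′} → Dec (Crossing w w′) → Poly
    afterCut {w} {w′} (yes _) = edgePoly (edge w w′) *ₚ G w′ v
    afterCut          (no _)  = 0ₚ

    fromCut : Fin size → Poly
    fromCut w = ∑ (λ w′ → afterCut (crossing? w w′))

    afterCut-¬ : ∀ {w w′} (d : Dec (Crossing w w′)) → ¬ Crossing w w′ → afterCut d ≋ 0ₚ
    afterCut-¬ (yes x) ¬x = ⊥-elim (¬x x)
    afterCut-¬ (no _)  ¬x = R.refl

    fromCut-high : ∀ {w} → ¬ Low w → fromCut w ≋ 0ₚ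
    fromCut-high ¬low = ∑-zero _ (λ w′ → afterCut-¬ (crossing? _ w′) (λ { (_ , low , _) → ¬low low }))

    -- The part of [x,v] that uses a crossing edge, sorted by its tail `w`. Low and high are always
    -- measured from `u`, whatever `x` is.
    through : Fin size → Poly
    through x = ∑ (λ w → G x w *ₚ fromCut w)

    Low-downward : ∀ {x y} → Path edge x y → Low y → Low x
    Low-downward {x} {y} p y-low = ℕₚ.≤-<-trans (p⊆q⇒∣p∣≤∣q∣ {p = X u x} {X u y} (X-monoʳ u p)) y-low

    -- Low nodes are closed under going backwards along paths, so beyond a high node no crossing
    -- edge is left.
    through-high : ∀ {y} → ¬ Low y → through y ≋ 0ₚ
    through-high {y} y-high = ∑-zero _ (λ w → term w (low? w))
      where
      term : ∀ w → Dec (Low w) → G y w *ₚ fromCut w ≋ 0ₚ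
      term w (no w-high) = R.trans (R.*-congˡ {G y w} (fromCut-high w-high)) (R.zeroʳ (G y w))
      term w (yes w-low) = R.*-congʳ {fromCut w} (unreachable (λ p → y-high (Low-downward p w-low)))

    -- A path either crosses on its first edge or does so beyond `y`. The identity matrix in
    -- `G-unfold` yields the first case, an exchange of sums the second.
    through-unfold : ∀ x → through x ≋ ∑ (λ y → afterCut (crossing? x y) +ₚ edgePoly (edge x y) *ₚ through y)
    through-unfold x = begin
      ∑ (λ w → G x w *ₚ K w)
        ≈⟨ sum-cong-≋ (λ w → R.*-congʳ {K w} (G-unfold x w)) ⟩
      ∑ (λ w → (δ w +ₚ ∑ (λ y → e y *ₚ G y w)) *ₚ K w)
        ≈⟨ sum-cong-≋ (λ w → R.distribʳ (K w) (δ w) _) ⟩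
      ∑ (λ w → δ w *ₚ K w +ₚ ∑ (λ y → e y *ₚ G y w) *ₚ K w)
        ≈⟨ ∑-distrib-+ (λ w → δ w *ₚ K w) (λ w → ∑ (λ y → e y *ₚ G y w) *ₚ K w) ⟩
      ∑ (λ w → δ w *ₚ K w) +ₚ ∑ (λ w → ∑ (λ y → e y *ₚ G y w) *ₚ K w)
        ≈⟨ R.+-cong diagonal (sum-cong-≋ (λ w → *-distribʳ-sum (K w) (λ y → e y *ₚ G y w))) ⟩
      K x +ₚ ∑ (λ w → ∑ (λ y → e y *ₚ G y w *ₚ K w))
        ≈⟨ R.+-congˡ {K x} (∑-comm (λ w y → e y *ₚ G y w *ₚ K w)) ⟩
      K x +ₚ ∑ (λ y → ∑ (λ w → e y *ₚ G y w *ₚ K w))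
        ≈⟨ R.+-congˡ {K x} (sum-cong-≋ (λ y → sum-cong-≋ (λ w → R.*-assoc (e y) (G y w) (K w)))) ⟩
      K x +ₚ ∑ (λ y → ∑ (λ w → e y *ₚ (G y w *ₚ K w)))
        ≈⟨ R.+-congˡ {K x} (sum-cong-≋ (λ y → *-distribˡ-sum (e y) (λ w → G y w *ₚ K w))) ⟨
      K x +ₚ ∑ (λ y → e y *ₚ through y)
        ≈⟨ ∑-distrib-+ (λ y → afterCut (crossing? x y)) (λ y → e y *ₚ through y) ⟨
      ∑ (λ y → afterCut (crossing? x y) +ₚ e y *ₚ through y) ∎
      where
      open SetoidReasoning R.setoid
      K : Fin size → Poly
      K = fromCut
      δ e : Fin size → Poly
      δ w = walkPoly edge 0 x w
      e y = edgePoly (edge x y)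
      diagonal : ∑ (λ w → δ w *ₚ K w) ≋ K x
      diagonal = R.trans
        (∑-single x (λ w → δ w *ₚ K w) (λ w w≢x → R.*-congʳ {K w} (walkPoly-0-≢ edge (w≢x ∘ ≡.sym))))
        (R.trans (R.*-congʳ {K x} (walkPoly-0-refl edge x)) (R.*-identityˡ (K x)))

    -- By `G-unfold` and `through-unfold` it suffices to compare edge by edge. If `y` is high and
    -- reaches `v`, the edge crosses and `through y` vanishes; if `y` is low, it does not cross and
    -- the induction hypothesis applies. The number `m` bounds the layers still ahead of `x`.
    cut-from : ¬ Low v → ∀ m x → ℓ ≤ depth x + m → Path edge u x → Low x → G x v ≋ through x
    cut-from v-high m x ℓ≤ p x-low = begin
      G x v
        ≈⟨ G-unfold x v ⟩
      walkPoly edge 0 x v +ₚ ∑ (λ y → edgePoly (edge x y) *ₚ G y v)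
        ≈⟨ R.+-cong (walkPoly-0-≢ edge {x} {v} λ { refl → v-high x-low }) (sum-cong-≋ (λ y → branch m ℓ≤ y (edge? x y) (low? y))) ⟩
      ∑ (λ y → afterCut (crossing? x y) +ₚ edgePoly (edge x y) *ₚ through y)
        ≈⟨ through-unfold x ⟨
      through x ∎
      where
      open SetoidReasoning R.setoid
      crossed : ∀ {y a} → edge x y ≡ just a → ¬ Low y → (d : Dec (Crossing x y)) →
        edgePoly (edge x y) *ₚ G y v ≋ afterCut d
      crossed xy y-high (yes _) = R.refl
      -- All other conditions hold, so only a path from `y` to `v` can be missing, and then `G y v`
      -- is 0.
      crossed {y} xy y-high (no ¬crossing) = R.trans
        (R.*-congˡ {edgePoly (edge x y)} (unreachable (λ q → ¬crossing (p , x-low , (_ , xy) , y-high , q))))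
        (R.zeroʳ (edgePoly (edge x y)))

      branch : ∀ m → ℓ ≤ depth x + m → ∀ y → Dec (∃[ a ] edge x y ≡ just a) → Dec (Low y) →
        edgePoly (edge x y) *ₚ G y v ≋ afterCut (crossing? x y) +ₚ edgePoly (edge x y) *ₚ through y
      branch m ℓ≤ y (no ¬xy) _ = R.trans (e≋0 (G y v)) (R.sym (R.+-cong
        (afterCut-¬ (crossing? x y) λ { (_ , _ , xy , _) → ¬xy xy }) (e≋0 (through y))))
        where
        e≋0 : ∀ q → edgePoly (edge x y) *ₚ q ≋ 0ₚ
        e≋0 q = R.reflexive (cong (λ e → edgePoly e *ₚ q) (no-edge ¬xy))
      branch m ℓ≤ y (yes (a , xy)) (no y-high) = R.trans (crossed xy y-high (crossing? x y)) (R.sym (R.trans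
        (R.+-congˡ {afterCut (crossing? x y)}
          (R.trans (R.*-congˡ {edgePoly (edge x y)} (through-high y-high)) (R.zeroʳ (edgePoly (edge x y)))))
        (R.+-identityʳ (afterCut (crossing? x y)))))
      branch zero ℓ≤ y (yes (a , xy)) (yes y-low) =
        ⊥-elim (ℕₚ.<⇒≱ (subst (_≤ ℓ) (edge-layer xy) (depth≤ℓ y)) (subst (ℓ ≤_) (ℕₚ.+-identityʳ _) ℓ≤))
      branch (suc m) ℓ≤ y (yes (a , xy)) (yes y-low) = R.trans
        (R.*-congˡ {edgePoly (edge x y)} (cut-from v-high m y
          (subst (ℓ ≤_) (≡.trans (ℕₚ.+-suc (depth x) m) (cong (_+ m) (≡.sym (edge-layer xy)))) ℓ≤)
          (_⊕_ edge p (step xy [])) y-low))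
        (R.sym (R.+-congʳ (afterCut-¬ (crossing? x y) λ { (_ , _ , _ , y-high , _) → y-high y-low })))

    cut : Low u → ¬ Low v → G u v ≋ ∑ (λ w → ∑ (λ w′ → G u w *ₚ afterCut (crossing? w w′)))
    cut u-low v-high = R.trans
      (cut-from v-high ℓ u (ℕₚ.m≤n+m ℓ _) [] u-low)
      (sum-cong-≋ (λ w → *-distribˡ-sum (G u w) (λ w′ → afterCut (crossing? w w′))))

  -- Formulas over blocks, with their bounds

  wholeProgram : Subprogram P
  wholeProgram = record
    { nodes       = Subset.⊤
    ; edge        = edge
    ; edge-nodes  = λ _ → ∈⊤ , ∈⊤
    ; edge-label  = id
    ; source      = source
    ; sink        = sink
    ; source∈     = ∈⊤
    ; sink∈       = ∈⊤
    ; sole-source = λ v _ → sole-source v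
    ; sole-sink   = λ u _ → sole-sink u
    }

  segment : Fin size → Fin size → Leaf P
  segment u v = record { program = wholeProgram ; u = u ; v = v ; u∈ = ∈⊤ ; v∈ = ∈⊤ }

  -- `V` stands in for the variables of the formula: products are shown syntactically multilinear
  -- from the disjointness of such sets. The finer equality `_≋_` is kept because it is readily a
  -- congruence for the product.
  record Realisation (V : Subset n) (g : Poly) (s d L : ℕ) : Set (c ⊔ˡ ℓ₁) where
    field
      formula         : Formula (Leaf P)
      vars⊆           : formulaVars leafVars formula ⊆ V
      multilinear     : SyntacticMultilinearFormula leafVars formula
      poly≋           : formulaPoly formula ≋ g
      size≤           : formulaSize formula ≤ s
      depth≤          : formulaDepth formula ≤ d
      leaves-small    : AllLeaves (λ w → Multilinear (leafPoly w) × ∣ leafVars w ∣ ≤ 1 √n) formula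
      parseTreeLeaves : (T : ParseTree formula) → leafCount T ≤ L
  open Realisation

  weaken : ∀ {V V′ g g′ s s′ d d′ L L′} → V ⊆ V′ → g ≋ g′ → s ≤ s′ → d ≤ d′ → L ≤ L′ →
    Realisation V g s d L → Realisation V′ g′ s′ d′ L′
  weaken V⊆ g≋ s≤ d≤ L≤ r = record
    { formula         = formula r
    ; vars⊆           = V⊆ ∘ vars⊆ r
    ; multilinear     = multilinear r
    ; poly≋           = R.trans (poly≋ r) g≋
    ; size≤           = ℕₚ.≤-trans (size≤ r) s≤
    ; depth≤          = ℕₚ.≤-trans (depth≤ r) d≤
    ; leaves-small    = leaves-small r
    ; parseTreeLeaves = λ T → ℕₚ.≤-trans (parseTreeLeaves r T) L≤
    }

  leafRealisation : ∀ u v → ∣ X u v ∣ ≤ 1 √n → Realisation (X u v) (G u v) 1 0 1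
  leafRealisation u v X≤√n = record
    { formula         = leaf (segment u v)
    ; vars⊆           = id
    ; multilinear     = Unit.tt
    ; poly≋           = R.refl
    ; size≤           = ℕₚ.≤-refl
    ; depth≤          = ℕₚ.≤-refl
    ; leaves-small    = G-multilinear u v , X≤√n
    ; parseTreeLeaves = λ { (leaf _) → ℕₚ.≤-refl }
    }

  -- The element of `Fin N` certifies N > 0, as sum gates have positive fan-in. A parse tree enters
  -- one summand, so `L` does not grow.
  sumRealisation : ∀ {N V s d L} {g : Fin N → Poly} → Fin N →
    (∀ i → Realisation V (g i) s d L) → Realisation V (∑ g) (suc (N * s)) (suc d) L
  sumRealisation {N = suc k} _ r = record
    { formula         = sum k (formula ∘ r)
    ; vars⊆           = foldr-∪-⊆ (formulaVars leafVars ∘ formula ∘ r) (λ i → vars⊆ (r i))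
    ; multilinear     = multilinear ∘ r
    ; poly≋           = sum-cong-≋ (poly≋ ∘ r)
    ; size≤           = s≤s (foldr-+-≤ (formulaSize ∘ formula ∘ r) (size≤ ∘ r))
    ; depth≤          = s≤s (foldr-⊔-≤ (formulaDepth ∘ formula ∘ r) (depth≤ ∘ r))
    ; leaves-small    = leaves-small ∘ r
    ; parseTreeLeaves = λ { (sum i T) → parseTreeLeaves (r i) T }
    }

  prodRealisation : ∀ {V W g h s s′ d d′ L L′} → (∀ {i} → i ∈ V → ¬ i ∈ W) →
    Realisation V g s d L → Realisation W h s′ d′ L′ →
    Realisation (V ∪ W) (g *ₚ h) (suc (s + s′)) (suc (d ⊔ d′)) (L + L′)
  prodRealisation V∩W≡∅ r r′ = record
    { formula         = prod (formula r) (formula r′)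
    ; vars⊆           = λ i∈ → x∈p∪q⁺ ([ inj₁ ∘ vars⊆ r , inj₂ ∘ vars⊆ r′ ]′ (x∈p∪q⁻ (vars r) (vars r′) i∈))
    ; multilinear     = (λ { (i , i∈) → let i∈r , i∈r′ = x∈p∩q⁻ (vars r) (vars r′) i∈ in
                             V∩W≡∅ (vars⊆ r i∈r) (vars⊆ r′ i∈r′) })
                      , multilinear r , multilinear r′
    ; poly≋           = R.*-cong (poly≋ r) (poly≋ r′)
    ; size≤           = s≤s (ℕₚ.+-mono-≤ (size≤ r) (size≤ r′))
    ; depth≤          = s≤s (ℕₚ.⊔-mono-≤ (depth≤ r) (depth≤ r′))
    ; leaves-small    = leaves-small r , leaves-small r′
    ; parseTreeLeaves = λ { (prod T T′) → ℕₚ.+-mono-≤ (parseTreeLeaves r T) (parseTreeLeaves r′ T′) }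
    }
    where
    vars : ∀ {V g s d L} → Realisation V g s d L → Subset n
    vars r = formulaVars leafVars (formula r)

  -- Recursive halving of blocks

  X-unreachable : ∀ {u v} {V : Subset n} → ¬ Path edge u v → X u v ⊆ V
  X-unreachable {u} {v} ¬p i∈ = ⊥-elim (¬p (proj₁ (∈-X⁻ u v i∈)))

  -- Splitting at `u` itself gives 2x ≤ x for x = |X u u|.
  ∣X∣-refl : ∀ u → ∣ X u u ∣ ≤ 0
  ∣X∣-refl u = ℕₚ.+-cancelˡ-≤ ∣ X u u ∣ ∣ X u u ∣ 0
    (subst (∣ X u u ∣ + ∣ X u u ∣ ≤_) (≡.sym (ℕₚ.+-identityʳ ∣ X u u ∣)) (∣X∣-split {u} {u} {u} [] []))

  -- The hypothesis `sink↛source` makes the block from sink to source equal to 0. It also separates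
  -- the two nodes, which gives the size at least 2 that `size-step` asks for.
  module Decomposition (k : ℕ) (1≤k : 1 ≤ k) (k²≤n : k * k ≤ n)
    (sink↛source : ¬ Path edge sink source) where

    2≤size : 2 ≤ size
    2≤size = distinct⇒2≤ sink source (λ sink≡source → sink↛source (subst (Path edge sink) sink≡source []))

    1≤size^ : ∀ m → 1 ≤ size ^ m
    1≤size^ = ℕₚ.m^n>0 size {{ℕ.>-nonZero (ℕₚ.≤-trans (s≤s z≤n) 2≤size)}}

    size^-suc : ∀ d → size ^ (5 * suc d) ≡ size ^ 5 * size ^ (5 * d)
    size^-suc d = ≡.trans (cong (size ^_) (ℕₚ.*-suc 5 d)) (ℕₚ.^-distribˡ-+-* size 5 (5 * d))

    size^-mono : ∀ d → size ^ (5 * d) ≤ size ^ (5 * suc d)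
    size^-mono d = subst₂ _≤_ (ℕₚ.*-identityˡ _) (≡.sym (size^-suc d)) (ℕₚ.*-monoˡ-≤ (size ^ (5 * d)) (1≤size^ 5))

    -- Fills the summands of pairs (w,w′) that are not crossing edges.
    zeroRealisation : ∀ {V} → Realisation V 0ₚ 1 0 1
    zeroRealisation = weaken (X-unreachable sink↛source) (unreachable sink↛source) ℕₚ.≤-refl ℕₚ.≤-refl ℕₚ.≤-refl
      (leafRealisation sink source (≤k⇒≤√n k²≤n (ℕₚ.≤-trans
        (p⊆q⇒∣p∣≤∣q∣ {p = X sink source} {⊥} (X-unreachable sink↛source)) (subst (_≤ k) (≡.sym (∣⊥∣≡0 n)) z≤n))))

    -- Here `d` counts the rounds still allowed. The bound `suc r ≤ 2 ^ d` survives a cut since the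
    -- larger part of `suc r` is its half rounded up; at `d = 0` only `r = 0` remains, a leaf.
    decompose : ∀ d r u v → suc r ≤ 2 ^ d → ∣ X u v ∣ < suc r * suc k →
      Realisation (X u v) (G u v) (size ^ (5 * d)) (4 * d) (1 + 2 * r)
    decompose d zero u v _ X< = weaken id R.refl (1≤size^ (5 * d)) z≤n ℕₚ.≤-refl
      (leafRealisation u v (≤k⇒≤√n k²≤n (ℕₚ.≤-pred (subst (∣ X u v ∣ <_) (ℕₚ.*-identityˡ (suc k)) X<))))
    decompose zero    (suc r) u v (s≤s ()) X<
    decompose (suc d) (suc r) u v r≤ X< = by (∣ X u v ∣ ℕ.<? t)
      where
      r₁ r₂ t : ℕ
      r₁ = ⌊ r /2⌋
      r₂ = ⌈ r /2⌉
      t  = suc r₁ * suc k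

      r₁+r₂≡r : r₁ + r₂ ≡ r
      r₁+r₂≡r = ℕₚ.⌊n/2⌋+⌈n/2⌉≡n r

      r₂< : suc r₂ ≤ 2 ^ d
      -- By computation `suc r₂` is half of `suc (suc r)`, rounded up, so it suffices to halve `r≤`.
      r₂< = subst (suc r₂ ≤_)
        (≡.sym (≡.trans (ℕₚ.n≡⌈n+n/2⌉ (2 ^ d)) (cong (λ m → ⌈ 2 ^ d + m /2⌉) (≡.sym (ℕₚ.+-identityʳ (2 ^ d))))))
        (ℕₚ.⌈n/2⌉-mono r≤)

      r₁< : suc r₁ ≤ 2 ^ d
      r₁< = ℕₚ.≤-trans (s≤s (ℕₚ.⌊n/2⌋≤⌈n/2⌉ r)) r₂<

      open Cut u v t

      suffix< : ∀ {w′} → Path edge u w′ → ¬ Low w′ → Path edge w′ v → ∣ X w′ v ∣ < suc r₂ * suc k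
      suffix< {w′} p w′-high q = ℕₚ.+-cancelˡ-< t _ _ (begin-strict
        t + ∣ X w′ v ∣             ≤⟨ ℕₚ.+-monoˡ-≤ ∣ X w′ v ∣ (ℕₚ.≮⇒≥ w′-high) ⟩
        ∣ X u w′ ∣ + ∣ X w′ v ∣    ≤⟨ ∣X∣-split p q ⟩
        ∣ X u v ∣                  <⟨ X< ⟩
        suc (suc r) * suc k        ≡⟨ cong (λ m → suc (suc m) * suc k) r₁+r₂≡r ⟨
        suc (suc r₁ + r₂) * suc k  ≡⟨ cong (_* suc k) (ℕₚ.+-suc (suc r₁) r₂) ⟨
        (suc r₁ + suc r₂) * suc k  ≡⟨ ℕₚ.*-distribʳ-+ (suc k) (suc r₁) (suc r₂) ⟩
        t + suc r₂ * suc k         ∎)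
        where open ℕₚ.≤-Reasoning

      leaves≡ : (1 + 2 * r₁) + (1 + (1 + 2 * r₂)) ≡ 1 + 2 * suc r
      leaves≡ = ≡.trans (collect r₁ r₂) (cong (λ m → 1 + 2 * suc m) r₁+r₂≡r)
        where
        collect : ∀ x y → (1 + 2 * x) + (1 + (1 + 2 * y)) ≡ 1 + 2 * suc (x + y)
        collect = solve-∀

      branch : ∀ w w′ (x : Dec (Crossing w w′)) → Realisation (X u v) (G u w *ₚ afterCut x)
        (suc (size ^ (5 * d) + suc (1 + size ^ (5 * d)))) (2 + 4 * d) (1 + 2 * suc r)
      branch w w′ (no _) = weaken id (R.sym (R.zeroʳ (G u w))) (s≤s z≤n) z≤n (s≤s z≤n) zeroRealisation
      branch w w′ (yes (p , w-low , (a , ww′) , w′-high , q)) =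
        weaken (λ i∈ → [ X-monoʳ u wv , X-monoˡ v p ∘ ⊆wv ]′ (x∈p∪q⁻ (X u w) _ i∈))
          (R.*-congˡ {G u w} (R.*-congʳ {G w′ v} (G-edge ww′)))
          ℕₚ.≤-refl
          (s≤s (ℕₚ.⊔-lub (ℕₚ.n≤1+n (4 * d)) ℕₚ.≤-refl))
          (ℕₚ.≤-reflexive leaves≡)
          (prodRealisation (λ i∈uw → X-disjoint u w v i∈uw ∘ ⊆wv)
            (decompose d r₁ u w r₁< w-low)
            (prodRealisation (X-disjoint w w′ v)
              (leafRealisation w w′ (≤k⇒≤√n k²≤n (ℕₚ.≤-trans (∣X∣-edge ww′) 1≤k)))
              (decompose d r₂ w′ v r₂< (suffix< (_⊕_ edge p (step ww′ [])) w′-high q))))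
        where
        wv : Path edge w v
        wv = step ww′ q
        ⊆wv : X w w′ ∪ X w′ v ⊆ X w v
        ⊆wv i∈ = [ X-monoʳ w q , X-monoˡ v (step ww′ []) ]′ (x∈p∪q⁻ (X w w′) (X w′ v) i∈)

      by : Dec (∣ X u v ∣ < t) →
        Realisation (X u v) (G u v) (size ^ (5 * suc d)) (4 * suc d) (1 + 2 * suc r)
      -- The end `v` is itself low, so there is nothing to cut; the block already meets the bound
      -- for `r₁`.
      by (yes X<t) = weaken id R.refl (size^-mono d) (ℕₚ.*-monoʳ-≤ 4 (ℕₚ.n≤1+n d))
        (s≤s (ℕₚ.*-monoʳ-≤ 2 (ℕₚ.≤-trans (ℕₚ.⌊n/2⌋≤n r) (ℕₚ.n≤1+n r))))
        (decompose d r₁ u v r₁< X<t)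
      -- The node `u` is low because `X u u` is empty and the threshold is positive.
      by (no X≮t) = weaken id (R.sym (cut (ℕₚ.≤-<-trans (∣X∣-refl u) (s≤s z≤n)) X≮t))
        (ℕₚ.≤-trans (size-step size (size ^ (5 * d)) 2≤size (1≤size^ (5 * d))) (ℕₚ.≤-reflexive (≡.sym (size^-suc d))))
        (ℕₚ.≤-reflexive (≡.sym (ℕₚ.*-suc 4 d)))
        ℕₚ.≤-refl
        (sumRealisation u λ w → sumRealisation u λ w′ → branch w w′ (crossing? w w′))

  -- A variable sits on an edge, so the source-to-sink path is not empty; a path back would close a
  -- cycle, against the layering. Without variables the two nodes may coincide.
  sink↛source : ∀ {i} → i ∈ X source sink → ¬ Path edge sink source
  sink↛source i∈ q with ∈-X⁻ source sink i∈
  ... | step {w = w} eq p , _ = no-descending-path (ℕₚ.≤-reflexive (≡.sym (edge-layer eq))) (_⊕_ edge p q)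

  realise : ∀ k → 1 ≤ k → k * k ≤ n → n < suc k * suc k →
    Realisation (X source sink) (G source sink) (size ^ (5 * ⌈log₂ n ⌉)) (4 * ⌈log₂ n ⌉) (1 + 2 * k)
  realise k 1≤k k²≤n n<[1+k]² = by (∣ X source sink ∣ ℕ.≤? k)
    where
    by : Dec (∣ X source sink ∣ ≤ k) → _
    -- One leaf suffices. This includes n = 1, where `⌈log₂ n ⌉` is 0 and no round is available.
    by (yes X≤k) = weaken id R.refl (ℕₚ.m^n>0 size {{Finₚ.nonZeroIndex source}} (5 * ⌈log₂ n ⌉)) z≤n (s≤s z≤n)
      (leafRealisation source sink (≤k⇒≤√n k²≤n X≤k))
    by (no X≰k) with nonempty? (X source sink)
    ... | no  empty = ⊥-elim (X≰k (subst (_≤ k) (≡.sym (≡.trans (cong ∣_∣ (Empty-unique empty)) (∣⊥∣≡0 n))) z≤n))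
    ... | yes (i , i∈) = Decomposition.decompose k 1≤k k²≤n (sink↛source i∈) ⌈log₂ n ⌉ k source sink
      -- More than k variables occur, so `suc k ≤ n`, and `⌈log₂ n ⌉` rounds are enough.
      (ℕₚ.≤-trans (ℕₚ.≤-trans (ℕₚ.≰⇒> X≰k) (∣p∣≤n (X source sink))) (n≤2^⌈log₂n⌉ n))
      (ℕₚ.≤-<-trans (∣p∣≤n (X source sink)) n<[1+k]²)

lemma4 : ∀ {c ℓ₁ ℓ₂} →
    Σ[ a ∈ ℕ ] Σ[ b ∈ ℕ ]
    ((F : HeytingField c ℓ₁ ℓ₂) (n : ℕ) → 1 ≤ n →
    let open Programs F n in
    (P : ABP) → ABP.SyntacticMultilinear P →
    (f : Poly) → Multilinear f → P Computes f →
    Σ[ Φ ∈ Formula (Leaf P) ]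
    ( SyntacticMultilinearFormula leafVars Φ
    × formulaPoly Φ ≈ₚ f
    × formulaSize Φ ≤ ABP.size P ^ (a * ⌈log₂ n ⌉)
    × formulaDepth Φ ≤ b * ⌈log₂ n ⌉
    × AllLeaves (λ w → Multilinear (leafPoly w) × ∣ leafVars w ∣ ≤ 1 √n) Φ
    × ((T : ParseTree Φ) → leafCount T ≤ 3 √n)))
-- The constants are those of one round: the factor S⁵ in `size-step` and the 4 levels in
-- `decompose`.
lemma4 = 5 , 4 , λ F n 1≤n P P-multilinear f _ P-computes-f →
  let k , k²≤n , n<[1+k]² = integerSqrt n
      1≤k = 1≤√n 1≤n k n<[1+k]²
      Φ = Program.realise F n P P-multilinear k 1≤k k²≤n n<[1+k]²
      open Program.Realisation Φ
  in formula
   , multilinear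
   , (λ m → HeytingField.trans F (Polynomials.≋⇒≈ₚ F n poly≋ m) (P-computes-f m))
   , size≤
   , depth≤
   , leaves-small
   , λ T → ≤1+2√n⇒≤3√n k 1≤k k²≤n (parseTreeLeaves T)
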